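{- For a poset $P$, we have $\operatorname{cw}(P) = |P|$ if and only if, writing $P=Q_1<\dots<Q_t$ for the block decomposition of $P$, $Q_t\in\mathbb{A}\cup\mathbb{B}\cup\{Z\}$ and, if $t>1$, every block of $P-Q_t$ (i.e., each of $Q_1,\dots,Q_{t-1}$) lies in $\mathbb{A}_{2,3,4}\cup\mathbb{B}\cup\{Z\}$.
   Context: All posets are finite with non-empty ground sets. An inclusion representation of $P$ is a family $\{S_x:x\in P\}$ with $x\le y$ iff $S_x\subseteq S_y$. $\operatorname{ch}(P)$ is the least $h$ such that $P$ has an inclusion representation with all $|S_x|\le h$; $\operatorname{cw}(P)$ is the least $w$ such that $P$ has an inclusion representation with ground set $\bigcup S_x$ of size $w$ and all $|S_x|\le\operatorname{ch}(P)$. The vertical sum $Q_1<\dots<Q_t$ has $x\le y$ iff $x,y\in Q_i$ with $x\le y$ in $Q_i$, or $x\in Q_i,y\in Q_j$, $i<j$. A block is a chain or a poset that is not a vertical sum of two non-empty posets; the block decomposition is $P$ itself if $P$ is a block, otherwise $P=Q_1<\dots<Q_t$ with least $t\ge2$ and all $Q_i$ blocks. $Z$ is the four-element poset with three components; $\mathbb{A}$ is the set of antichains with at least two elements; $\mathbb{A}_{2,3,4}$ the antichains of sizes 2, 3, 4; $\mathbb{B}$ the posets $C+T$ (disjoint sum) with $C$ a chain of at least two elements and $T$ a one-element poset. -}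

module Defs where

open import Data.Nat using (ℕ; zero; suc; _≤_; _<_)
open import Data.Fin using (Fin; zero; suc; toℕ; fromℕ; inject₁)
import Data.Fin as F
open import Data.Fin.Subset using (Subset; _⊆_; ∣_∣; ⋃)
open import Data.List using (tabulate)
open import Data.Bool using (Bool; true; false)
open import Data.Product using (Σ; ∃; _×_; _,_)
open import Data.Sum using (_⊎_)
open import Data.Empty using (⊥)
open import Data.Unit using (⊤)
open import Relation.Nullary using (¬_)
open import Relation.Binary.PropositionalEquality using (_≡_)
open import Relation.Binary using (IsPartialOrder; Decidable)
open import Function.Definitions using (Injective)

record FinPoset : Set₁ where
  field
    size           : ℕ
    nonEmpty       : 0 < size
    _≼_            : Fin size → Fin size → Set
    isPartialOrder : IsPartialOrder _≡_ _≼_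
    _≼?_           : Decidable _≼_

open FinPoset public

-- S : Fin (size P) → Subset m is an inclusion representation of P
-- (ground set Fin m, the realised ground set is ⋃ S_x).
IsInclRep : (P : FinPoset) (m : ℕ) → (Fin (size P) → Subset m) → Set
IsInclRep P m S =
  ∀ x y → (_≼_ P x y → S x ⊆ S y) × (S x ⊆ S y → _≼_ P x y)

unionSize : (P : FinPoset) {m : ℕ} → (Fin (size P) → Subset m) → ℕ
unionSize P S = ∣ ⋃ (tabulate S) ∣

Bounded : (P : FinPoset) {m : ℕ} → (Fin (size P) → Subset m) → ℕ → Set
Bounded P S h = ∀ x → ∣ S x ∣ ≤ h

IsCh : FinPoset → ℕ → Set
IsCh P h =
  (Σ ℕ λ m → Σ (Fin (size P) → Subset m) λ S → IsInclRep P m S × Bounded P S h)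
  × (∀ h' m (S : Fin (size P) → Subset m) → IsInclRep P m S → Bounded P S h' → h ≤ h')

IsCw : FinPoset → ℕ → Set
IsCw P w = Σ ℕ λ h → IsCh P h
  × (Σ ℕ λ m → Σ (Fin (size P) → Subset m) λ S →
        IsInclRep P m S × Bounded P S h × unionSize P S ≡ w)
  × (∀ m (S : Fin (size P) → Subset m) → IsInclRep P m S → Bounded P S h →
        w ≤ unionSize P S)

Sub : FinPoset → Set₁
Sub P = Fin (size P) → Set

Whole : (P : FinPoset) → Sub P
Whole P _ = ⊤

IsChainOn : (P : FinPoset) → Sub P → Set
IsChainOn P U = ∀ x y → U x → U y → _≼_ P x y ⊎ _≼_ P y x

-- the induced subposet on U is a vertical sum Q₁ < Q₂ of two non-empty
-- posets (Q₁ = the part where c is false, Q₂ = where c is true)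
IsVSum2On : (P : FinPoset) → Sub P → Set
IsVSum2On P U = Σ (Fin (size P) → Bool) λ c →
    (∃ λ x → U x × c x ≡ false)
  × (∃ λ y → U y × c y ≡ true)
  × (∀ x y → U x → U y → c x ≡ false → c y ≡ true → _≼_ P x y)

IsBlockOn : (P : FinPoset) → Sub P → Set
IsBlockOn P U = IsChainOn P U ⊎ ¬ IsVSum2On P U

IsoOn : (P : FinPoset) → Sub P → (k : ℕ) → (Fin k → Fin k → Set) → Set
IsoOn P U k R = Σ (Fin k → Fin (size P)) λ f →
    (∀ j → U (f j))
  × (∀ x → U x → ∃ λ j → f j ≡ x)
  × Injective _≡_ _≡_ f
  × (∀ i j → (R i j → _≼_ P (f i) (f j)) × (_≼_ P (f i) (f j) → R i j))

AntichainRel : (k : ℕ) → Fin k → Fin k → Set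
AntichainRel k i j = i ≡ j

-- C + T with C a chain of m elements: element zero is T,
-- elements suc i form the chain (ordered as in Fin m)
ChainPlusPointRel : (m : ℕ) → Fin (suc m) → Fin (suc m) → Set
ChainPlusPointRel m zero    j       = j ≡ zero
ChainPlusPointRel m (suc i) zero    = ⊥
ChainPlusPointRel m (suc i) (suc j) = i F.≤ j

ZRel : Fin 4 → Fin 4 → Set
ZRel i j = i ≡ j ⊎ (i ≡ zero × j ≡ suc zero)

InA : (P : FinPoset) → Sub P → Set
InA P U = Σ ℕ λ k → 2 ≤ k × IsoOn P U k (AntichainRel k)

InA234 : (P : FinPoset) → Sub P → Set
InA234 P U = Σ ℕ λ k → 2 ≤ k × k ≤ 4 × IsoOn P U k (AntichainRel k)

InB : (P : FinPoset) → Sub P → Set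
InB P U = Σ ℕ λ m → 2 ≤ m × IsoOn P U (suc m) (ChainPlusPointRel m)

IsZ : (P : FinPoset) → Sub P → Set
IsZ P U = IsoOn P U 4 ZRel

Part : (P : FinPoset) {t : ℕ} → (Fin (size P) → Fin t) → Fin t → Sub P
Part P b i x = b x ≡ i

-- P = Q₁ < … < Q_t where Q_i is the induced subposet on b⁻¹(i),
-- each Q_i non-empty
IsVSum : (P : FinPoset) (t : ℕ) → (Fin (size P) → Fin t) → Set
IsVSum P t b = (∀ i → ∃ λ x → b x ≡ i)
  × (∀ x y → b x F.< b y → _≼_ P x y)

AllBlocks : (P : FinPoset) (t : ℕ) → (Fin (size P) → Fin t) → Set
AllBlocks P t b = ∀ i → IsBlockOn P (Part P b i)

IsBlockDecomposition : (P : FinPoset) (k : ℕ) → (Fin (size P) → Fin (suc k)) → Set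
IsBlockDecomposition P k b = IsVSum P (suc k) b ×
  ( (k ≡ 0 × IsBlockOn P (Whole P))
  ⊎ ( ¬ IsBlockOn P (Whole P) × 1 ≤ k × AllBlocks P (suc k) b
    × (∀ t' (b' : Fin (size P) → Fin t') → 2 ≤ t' → IsVSum P t' b' →
         AllBlocks P t' b' → suc k ≤ t')))

CwCondition : (P : FinPoset) (k : ℕ) → (Fin (size P) → Fin (suc k)) → Set
CwCondition P k b =
    (InA P (Part P b (fromℕ k)) ⊎ InB P (Part P b (fromℕ k)) ⊎ IsZ P (Part P b (fromℕ k)))
  × (∀ (j : Fin k) → InA234 P (Part P b (inject₁ j)) ⊎ InB P (Part P b (inject₁ j))
                      ⊎ IsZ P (Part P b (inject₁ j)))

{-# OPTIONS --safe #-}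

-- Write ↓x for principal down-sets. From any representation with sets of size at most h < max ∣↓x∣ one obtains, by
-- an exchange argument, one with the same bound and fewer than ∣P∣ points; hence cw(P) = ∣P∣ says exactly that no
-- representation with all ∣Sₓ∣ ≤ max ∣↓x∣ has fewer than ∣P∣ points.
--
-- Necessity: unless a block has the required shape, the representation by down-sets can be modified locally so that
-- one point d ∈ P is no longer used. For an indecomposable block that is not a chain, look at its maximal elements:
-- two whose strict down-sets D are incomparable can share a point; otherwise the sets D form a chain, and only
-- antichains or the case of two or three maxima, all but one with the same minimal D, resist. In the latter case,
-- descending from the maximum with the largest D along unique lower covers either meets an element that is
-- redundant in the representation, or splits the block, or shows that it is a chain plus one or two isolated points.
-- For the lowest chain block, delete the point of its least element: the block below is not a chain and so has no
-- maximum, which keeps that element separated from everything lower.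
--
-- Sufficiency: adding the blocks from bottom to top, each block Q increases the union by at least ∣Q∣ points. For
-- antichains of at most four elements and for Z a finite search shows that ∣Q∣ − 1 points do not separate Q; a top
-- antichain is controlled by the bound on the sizes.

module Submission where

open import Defs
open import Data.Bool using (true; false; not)
open import Data.Empty using (⊥; ⊥-elim)
open import Data.Fin using (Fin; zero; suc; toℕ; #_)
import Data.Fin as F
open import Data.Fin.Induction using (<-weakInduction)
open import Data.Fin.Properties
  using (any?; all?; ¬∀⟶∃¬; _≟_; suc-injective; toℕ-inject₁; toℕ-fromℕ; toℕ-injective; inject≤-injective; toℕ≤pred[n])
import Data.Fin.Properties as FP
open import Data.Fin.Subset using (Subset; _∈_; _∉_; _⊆_; ∣_∣; _∪_; _∩_; _─_; _-_; ∁; ⁅_⁆; ⋃; ⊤)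
  renaming (⊥ to ∅)
open import Data.Fin.Subset.Properties
open import Data.List using () renaming (tabulate to tabulateL)
open import Data.Nat using (ℕ; zero; suc; _+_; _∸_; _≤_; _<_; z≤n; s≤s; _≤?_; _<?_)
open import Data.Nat.Properties hiding (_≟_; _≤?_; _<?_; suc-injective)
open import Data.Product using (Σ; ∃; _×_; _,_; proj₁; proj₂)
open import Data.Sum using (_⊎_; inj₁; inj₂; [_,_]′)
open import Data.Vec using (Vec; []; _∷_; here; there; lookup; tabulate; _++_; replicate)
open import Data.Vec.Properties using ([]=⇒lookup; lookup⇒[]=; lookup∘tabulate)
open import Function using (_∘_; id; case_of_)
open import Function.Definitions using (Injective)
open import Relation.Binary using (IsPartialOrder; tri<; tri≈; tri>)
open import Relation.Binary.PropositionalEquality using (_≡_; _≢_; refl; sym; trans; cong; subst; subst₂)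
open import Relation.Nullary using (Dec; yes; no; does; ¬_; ¬?; contradiction)
open import Relation.Nullary.Decidable
  using (_×-dec_; _→-dec_; _⊎-dec_; decidable-stable; dec-true; dec-false; from-yes; from-no; map′)
open import Relation.Unary using (Decidable)

-- Cardinalities of finite sets

module _ {n : ℕ} {Q : Fin n → Set} (Q? : Decidable Q) where

  comprehension : Subset n
  comprehension = tabulate (does ∘ Q?)

  ∈-comprehension⁺ : ∀ {x} → Q x → x ∈ comprehension
  ∈-comprehension⁺ {x} q =
    lookup⇒[]= x _ (trans (lookup∘tabulate (does ∘ Q?) x) (dec-true (Q? x) q))

  ∈-comprehension⁻ : ∀ {x} → x ∈ comprehension → Q x
  ∈-comprehension⁻ {x} x∈ with Q? x | trans (sym (lookup∘tabulate (does ∘ Q?) x)) ([]=⇒lookup x∈)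
  ... | yes q | _ = q
  ... | no _  | ()

∣p∪q∣≡∣p∣+∣q─p∣ : ∀ {n} (p q : Subset n) → ∣ p ∪ q ∣ ≡ ∣ p ∣ + ∣ q ─ p ∣
∣p∪q∣≡∣p∣+∣q─p∣ []          []          = refl
∣p∪q∣≡∣p∣+∣q─p∣ (true  ∷ p) (_     ∷ q) = cong suc (∣p∪q∣≡∣p∣+∣q─p∣ p q)
∣p∪q∣≡∣p∣+∣q─p∣ (false ∷ p) (false ∷ q) = ∣p∪q∣≡∣p∣+∣q─p∣ p q
∣p∪q∣≡∣p∣+∣q─p∣ (false ∷ p) (true  ∷ q) =
  trans (cong suc (∣p∪q∣≡∣p∣+∣q─p∣ p q)) (sym (+-suc ∣ p ∣ ∣ q ─ p ∣))

∣p∩q∣+∣p─q∣≡∣p∣ : ∀ {n} (p q : Subset n) → ∣ p ∩ q ∣ + ∣ p ─ q ∣ ≡ ∣ p ∣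
∣p∩q∣+∣p─q∣≡∣p∣ []          []          = refl
∣p∩q∣+∣p─q∣≡∣p∣ (false ∷ p) (false ∷ q) = ∣p∩q∣+∣p─q∣≡∣p∣ p q
∣p∩q∣+∣p─q∣≡∣p∣ (false ∷ p) (true  ∷ q) = ∣p∩q∣+∣p─q∣≡∣p∣ p q
∣p∩q∣+∣p─q∣≡∣p∣ (true  ∷ p) (true  ∷ q) = cong suc (∣p∩q∣+∣p─q∣≡∣p∣ p q)
∣p∩q∣+∣p─q∣≡∣p∣ (true  ∷ p) (false ∷ q) =
  trans (+-suc ∣ p ∩ q ∣ ∣ p ─ q ∣) (cong suc (∣p∩q∣+∣p─q∣≡∣p∣ p q))

∣p∪q∣≤∣p∣+∣q∣ : ∀ {n} (p q : Subset n) → ∣ p ∪ q ∣ ≤ ∣ p ∣ + ∣ q ∣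
∣p∪q∣≤∣p∣+∣q∣ p q = subst (_≤ ∣ p ∣ + ∣ q ∣) (sym (∣p∪q∣≡∣p∣+∣q─p∣ p q)) (+-monoʳ-≤ ∣ p ∣ (∣p─q∣≤∣p∣ q p))

∣p∪⁅x⁆∣≤1+∣p∣ : ∀ {n} (p : Subset n) x → ∣ p ∪ ⁅ x ⁆ ∣ ≤ suc ∣ p ∣
∣p∪⁅x⁆∣≤1+∣p∣ p x = subst (∣ p ∪ ⁅ x ⁆ ∣ ≤_) (trans (cong (∣ p ∣ +_) (∣⁅x⁆∣≡1 x)) (+-comm ∣ p ∣ 1)) (∣p∪q∣≤∣p∣+∣q∣ p ⁅ x ⁆)

∣p∣<∣p∪⁅x⁆∣ : ∀ {n} (p : Subset n) {x} → x ∉ p → ∣ p ∣ < ∣ p ∪ ⁅ x ⁆ ∣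
∣p∣<∣p∪⁅x⁆∣ p {x} x∉p = p⊂q⇒∣p∣<∣q∣ {q = p ∪ ⁅ x ⁆} (p⊆p∪q ⁅ x ⁆ , x , x∈p∪q⁺ {p = p} (inj₂ (x∈⁅x⁆ x)) , x∉p)

∣p++q∣≡∣p∣+∣q∣ : ∀ {m n} (p : Subset m) (q : Subset n) → ∣ p ++ q ∣ ≡ ∣ p ∣ + ∣ q ∣
∣p++q∣≡∣p∣+∣q∣ []          q = refl
∣p++q∣≡∣p∣+∣q∣ (true  ∷ p) q = cong suc (∣p++q∣≡∣p∣+∣q∣ p q)
∣p++q∣≡∣p∣+∣q∣ (false ∷ p) q = ∣p++q∣≡∣p∣+∣q∣ p q

++-⊆⁺ : ∀ {m n} {p p′ : Subset m} {q q′ : Subset n} → p ⊆ p′ → q ⊆ q′ → p ++ q ⊆ p′ ++ q′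
++-⊆⁺ {p = []}    {[]}     p⊆ q⊆ x∈ = q⊆ x∈
++-⊆⁺ {p = _ ∷ p} {_ ∷ p′} p⊆ q⊆ here with p⊆ here
... | here = here
++-⊆⁺ {p = _ ∷ p} {_ ∷ p′} p⊆ q⊆ (there x∈) = there (++-⊆⁺ (drop-∷-⊆ p⊆) q⊆ x∈)

++-⊆⁻ : ∀ {m n} (p p′ : Subset m) {q q′ : Subset n} → p ++ q ⊆ p′ ++ q′ → p ⊆ p′ × q ⊆ q′
++-⊆⁻ []      []       ⊆′ = (λ ()) , ⊆′
++-⊆⁻ (s ∷ p) (s′ ∷ p′) ⊆′ = p⊆ , proj₂ rest
  where
  rest = ++-⊆⁻ p p′ (drop-∷-⊆ ⊆′)
  p⊆ : s ∷ p ⊆ s′ ∷ p′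
  p⊆ here with ⊆′ here
  ... | here = here
  p⊆ (there x∈) = there (proj₁ rest x∈)

x∈p─q⇒x∉q : ∀ {n} {x : Fin n} (p q : Subset n) → x ∈ p ─ q → x ∉ q
x∈p─q⇒x∉q (_ ∷ p) (false ∷ q) (there x∈) (there x∈q) = x∈p─q⇒x∉q p q x∈ x∈q
x∈p─q⇒x∉q (_ ∷ p) (true  ∷ q) (there x∈) (there x∈q) = x∈p─q⇒x∉q p q x∈ x∈q

∈⋃⁺ : ∀ {m n} (S : Fin n → Subset m) x → S x ⊆ ⋃ (tabulateL S)
∈⋃⁺ S zero    e∈ = x∈p∪q⁺ (inj₁ e∈)
∈⋃⁺ S (suc x) e∈ = x∈p∪q⁺ {p = S zero} (inj₂ (∈⋃⁺ (S ∘ suc) x e∈))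

∈⋃⁻ : ∀ {m n} (S : Fin n → Subset m) {e} → e ∈ ⋃ (tabulateL S) → ∃ λ x → e ∈ S x
∈⋃⁻ {n = zero}  S e∈ = contradiction e∈ ∉⊥
∈⋃⁻ {n = suc n} S e∈ with x∈p∪q⁻ (S zero) _ e∈
... | inj₁ e∈S₀ = zero , e∈S₀
... | inj₂ e∈⋃ with ∈⋃⁻ (S ∘ suc) e∈⋃
...   | x , e∈Sx = suc x , e∈Sx

-- Choosing an extremal element of a nonempty decidable set for a relation that is total on it.
extremum : ∀ {n} {Q : Fin n → Set} (Q? : Decidable Q) {R : Fin n → Fin n → Set} →
           (∀ x → R x x) → (∀ {x y z} → R x y → R y z → R x z) →
           (∀ x y → Q x → Q y → R x y ⊎ R y x) →
           ∃ Q → ∃ λ b → Q b × (∀ x → Q x → R x b)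
extremum {zero} Q? rfl trn tot (() , _)
extremum {suc n} {Q} Q? {R} rfl trn tot (w , qw) with any? (Q? ∘ suc)
... | no none = zero , q₀ w qw , λ { zero _ → rfl zero ; (suc x) qx → contradiction (x , qx) none }
  where
  q₀ : ∀ w → Q w → Q zero
  q₀ zero    q = q
  q₀ (suc x) q = contradiction (x , q) none
... | yes some with extremum (Q? ∘ suc) {λ x y → R (suc x) (suc y)} (rfl ∘ suc) trn (λ x y → tot (suc x) (suc y)) some | Q? zero
...   | b , qb , best | no ¬q₀ = suc b , qb , λ { zero q → contradiction q ¬q₀ ; (suc x) → best x }
...   | b , qb , best | yes q₀ with tot zero (suc b) q₀ qb
...     | inj₁ r = suc b , qb , λ { zero _ → r ; (suc x) → best x }
...     | inj₂ r = zero , q₀ , λ { zero _ → rfl zero ; (suc x) q → trn (best x q) r }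

∉-minus : ∀ {n} (p : Subset n) x → x ∉ p - x
∉-minus p x x∈ = x∈p─q⇒x∉q p ⁅ x ⁆ x∈ (x∈⁅x⁆ x)

∈-minus⁻ : ∀ {n} (p : Subset n) {x y} → x ∈ p - y → x ∈ p × x ≢ y
∈-minus⁻ p {x} {y} x∈ = p─q⊆p p ⁅ y ⁆ x∈ , λ { refl → ∉-minus p x x∈ }

enumerate : ∀ {n} {Q : Fin n → Set} → Decidable Q → Σ ℕ λ k → Σ (Fin k → Fin n) λ f →
            (∀ j → Q (f j)) × (∀ x → Q x → ∃ λ j → f j ≡ x) × Injective _≡_ _≡_ f
enumerate {zero} Q? = 0 , (λ ()) , (λ ()) , (λ ()) , λ { {()} }
enumerate {suc n} Q? with enumerate (Q? ∘ suc) | Q? zero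
... | k , f , Qf , onto , inj | no ¬q₀ = k , suc ∘ f , Qf ,
  (λ { zero q → contradiction q ¬q₀ ; (suc x) q → let j , fj≡x = onto x q in j , cong suc fj≡x }) ,
  inj ∘ suc-injective
... | k , f , Qf , onto , inj | yes q₀ = suc k , g ,
  (λ { zero → q₀ ; (suc j) → Qf j }) ,
  (λ { zero _ → zero , refl ; (suc x) q → let j , fj≡x = onto x q in suc j , cong suc fj≡x }) ,
  g-injective
  where
  g : Fin (suc k) → Fin (suc _)
  g zero    = zero
  g (suc j) = suc (f j)
  g-injective : Injective _≡_ _≡_ g
  g-injective {zero}  {zero}  _  = refl
  g-injective {suc i} {suc j} eq = cong suc (inj (suc-injective eq))

∣p∣≤∣q∣+k : ∀ {n k} (p q : Subset n) (f : Fin k → Fin n) → (∀ {x} → x ∈ p → x ∈ q ⊎ ∃ λ j → f j ≡ x) → ∣ p ∣ ≤ ∣ q ∣ + k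
∣p∣≤∣q∣+k {k = zero} p q f cover = subst (∣ p ∣ ≤_) (sym (+-identityʳ ∣ q ∣)) (p⊆q⇒∣p∣≤∣q∣ p⊆q)
  where
  p⊆q : p ⊆ q
  p⊆q x∈ with cover x∈
  ... | inj₁ x∈q = x∈q
∣p∣≤∣q∣+k {k = suc k} p q f cover = begin
  ∣ p ∣                     ≤⟨ ∣p∣≤∣q∣+k p (q ∪ ⁅ f zero ⁆) (f ∘ suc) cover′ ⟩
  ∣ q ∪ ⁅ f zero ⁆ ∣ + k   ≤⟨ +-monoˡ-≤ k (∣p∪⁅x⁆∣≤1+∣p∣ q (f zero)) ⟩
  suc ∣ q ∣ + k             ≡⟨ +-suc ∣ q ∣ k ⟨
  ∣ q ∣ + suc k             ∎
  where
  open ≤-Reasoning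
  cover′ : ∀ {x} → x ∈ p → x ∈ q ∪ ⁅ f zero ⁆ ⊎ ∃ λ j → f (suc j) ≡ x
  cover′ x∈ with cover x∈
  ... | inj₁ x∈q           = inj₁ (x∈p∪q⁺ (inj₁ x∈q))
  ... | inj₂ (zero , refl) = inj₁ (x∈p∪q⁺ {p = q} (inj₂ (x∈⁅x⁆ (f zero))))
  ... | inj₂ (suc j , eq)  = inj₂ (j , eq)

∣p∣+k≤∣q∣ : ∀ {n k} (p q : Subset n) (f : Fin k → Fin n) → p ⊆ q → Injective _≡_ _≡_ f →
            (∀ j → f j ∈ q × f j ∉ p) → ∣ p ∣ + k ≤ ∣ q ∣
∣p∣+k≤∣q∣ {k = zero} p q f p⊆q _ _ = subst (_≤ ∣ q ∣) (sym (+-identityʳ ∣ p ∣)) (p⊆q⇒∣p∣≤∣q∣ p⊆q)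
∣p∣+k≤∣q∣ {k = suc k} p q f p⊆q inj new = begin
  ∣ p ∣ + suc k             ≡⟨ +-suc ∣ p ∣ k ⟩
  suc ∣ p ∣ + k             ≤⟨ +-monoˡ-≤ k (∣p∣<∣p∪⁅x⁆∣ p (proj₂ (new zero))) ⟩
  ∣ p ∪ ⁅ f zero ⁆ ∣ + k   ≤⟨ ∣p∣+k≤∣q∣ (p ∪ ⁅ f zero ⁆) q (f ∘ suc) p′⊆q (suc-injective ∘ inj) new′ ⟩
  ∣ q ∣                     ∎
  where
  open ≤-Reasoning
  p′⊆q : p ∪ ⁅ f zero ⁆ ⊆ q
  p′⊆q x∈ with x∈p∪q⁻ p ⁅ f zero ⁆ x∈
  ... | inj₁ x∈p = p⊆q x∈p
  ... | inj₂ x∈f rewrite x∈⁅y⁆⇒x≡y (f zero) x∈f = proj₁ (new zero)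
  new′ : ∀ j → f (suc j) ∈ q × f (suc j) ∉ p ∪ ⁅ f zero ⁆
  new′ j = proj₁ (new (suc j)) , λ fj∈ → case x∈p∪q⁻ p ⁅ f zero ⁆ fj∈ of λ where
    (inj₁ fj∈p)  → proj₂ (new (suc j)) fj∈p
    (inj₂ fj∈f₀) → case inj (x∈⁅y⁆⇒x≡y (f zero) fj∈f₀) of λ ()

-- Recolouring schemes for maximal elements

-- Recipe for recolouring an antichain of v maximal points: σ i gives up its own ground point for those of p i and
-- q i, and the ground point of σ i₀ becomes unused.
record Scheme (v r : ℕ) (σ p q : Fin r → Fin v) (i₀ : Fin r) : Set where
  field
    σ-injective : ∀ i j → σ i ≡ σ j → i ≡ j
    p≢d         : ∀ i → p i ≢ σ i₀
    q≢d         : ∀ i → q i ≢ σ i₀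
    p≢q         : ∀ i → p i ≢ q i
    separating  : ∀ i j → i ≢ j → ∃ λ k → (k ≡ p i ⊎ k ≡ q i) × k ≢ p j × k ≢ q j

scheme? : ∀ {v r} (σ p q : Fin r → Fin v) i₀ → Dec (Scheme v r σ p q i₀)
scheme? σ p q i₀ with all? (λ i → all? λ j → σ i ≟ σ j →-dec i ≟ j)
  ×-dec all? (λ i → ¬? (p i ≟ σ i₀)) ×-dec all? (λ i → ¬? (q i ≟ σ i₀)) ×-dec all? (λ i → ¬? (p i ≟ q i))
  ×-dec all? (λ i → all? λ j → ¬? (i ≟ j) →-dec any? λ k → (k ≟ p i ⊎-dec k ≟ q i) ×-dec ¬? (k ≟ p j) ×-dec ¬? (k ≟ q j))
... | yes (a , b , c , d , e) = yes record { σ-injective = a ; p≢d = b ; q≢d = c ; p≢q = d ; separating = e }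
... | no ¬all = no λ sc → let open Scheme sc in ¬all (σ-injective , p≢d , q≢d , p≢q , separating)

-- Point 0 takes the ground points of 1 and 2, and its own is freed; 1 and 2 keep their sets.
oneOfThree : Scheme 3 1 (λ _ → # 0) (λ _ → # 1) (λ _ → # 2) (# 0)
oneOfThree = from-yes (scheme? {3} {1} (λ _ → # 0) (λ _ → # 1) (λ _ → # 2) (# 0))

-- Points 0, 1 and 2 receive the three two-element subsets of {0, 1, 3}; point 3 keeps its set, and
-- the ground point of 2 is freed.
threeOfFour : Scheme 4 3 F.inject₁ (lookup (# 3 ∷ # 0 ∷ # 3 ∷ [])) (lookup (# 0 ∷ # 1 ∷ # 1 ∷ [])) (# 2)
threeOfFour = from-yes
  (scheme? {4} {3} F.inject₁ (lookup (# 3 ∷ # 0 ∷ # 3 ∷ [])) (lookup (# 0 ∷ # 1 ∷ # 1 ∷ [])) (# 2))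

-- Five points become five of the six two-element subsets of four of them.
fiveOfFive : Scheme 5 5 id (lookup (# 0 ∷ # 0 ∷ # 0 ∷ # 1 ∷ # 1 ∷ [])) (lookup (# 1 ∷ # 2 ∷ # 3 ∷ # 2 ∷ # 3 ∷ [])) (# 4)
fiveOfFive = from-yes
  (scheme? {5} {5} id (lookup (# 0 ∷ # 0 ∷ # 0 ∷ # 1 ∷ # 1 ∷ [])) (lookup (# 1 ∷ # 2 ∷ # 3 ∷ # 2 ∷ # 3 ∷ [])) (# 4))

-- Finite searches: posets that need as many ground points as elements

values : ∀ {m c} {A : Set} → A → (X : Subset m) → ∣ X ∣ ≤ c → (v : Fin m → A) →
         Σ (Vec A c) λ as → ∀ {e} → e ∈ X → ∃ λ l → lookup as l ≡ v e
-- `a` pads the vector, so a set with fewer than `c` elements still gives length exactly `c`.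
values a [] _ v = replicate _ a , λ ()
values a (false ∷ X) ∣X∣≤c v with values a X ∣X∣≤c (v ∘ suc)
... | as , hit = as , λ { (there e∈) → hit e∈ }
values a (true ∷ X) (s≤s ∣X∣≤c) v with values a X ∣X∣≤c (v ∘ suc)
... | as , hit = v zero ∷ as , λ { here → zero , refl ; (there e∈) → let l , eq = hit e∈ in suc l , eq }

-- A ground point is recorded by the set of those elements of a k-element poset whose sets contain it.
Separates : ∀ {k c} → (Fin k → Fin k → Set) → Vec (Subset k) c → Set
Separates R ps = ∀ i j → ¬ R i j → ∃ λ l → i ∈ lookup ps l × j ∉ lookup ps l

separates? : ∀ {k c} {R : Fin k → Fin k → Set} → (∀ i j → Dec (R i j)) → (ps : Vec (Subset k) c) → Dec (Separates R ps)
separates? R? ps = all? λ i → all? λ j → ¬? (R? i j) →-dec any? λ l → i ∈? lookup ps l ×-dec ¬? (j ∈? lookup ps l)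

anyVec? : ∀ {k} c {Q : Vec (Subset k) c → Set} → Decidable Q → Dec (∃ Q)
anyVec? zero    Q? = map′ ([] ,_) (λ { ([] , q) → q }) (Q? [])
anyVec? (suc c) Q? = map′ (λ { (p , ps , q) → p ∷ ps , q }) (λ { (p ∷ ps , q) → p , ps , q })
  (anySubset? λ p → anyVec? c λ ps → Q? (p ∷ ps))

-- One ground point fewer than there are elements never suffices. Patterns may repeat, so length
-- exactly `k` covers smaller numbers as well.
Incompressible : ∀ {k} → (Fin (suc k) → Fin (suc k) → Set) → Set
Incompressible {k} R = ¬ (∃ λ (ps : Vec (Subset (suc k)) k) → Separates R ps)

antichain₂ : Incompressible (AntichainRel 2)
antichain₂ = from-no (anyVec? {2} 1 (separates? _≟_))

antichain₃ : Incompressible (AntichainRel 3)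
antichain₃ = from-no (anyVec? {3} 2 (separates? _≟_))

-- Three points carry at most three pairwise incomparable sets, but four carry six, so antichains of
-- five elements are already compressible.
antichain₄ : Incompressible (AntichainRel 4)
antichain₄ = from-no (anyVec? {4} 3 (separates? _≟_))

ZRel? : ∀ i j → Dec (ZRel i j)
ZRel? i j = i ≟ j ⊎-dec i ≟ zero ×-dec j ≟ suc zero

z-incompressible : Incompressible ZRel
z-incompressible = from-no (anyVec? {4} 3 (separates? ZRel?))

-- Principal down-sets and the reduction to representations bounded by their sizes

module _ (P : FinPoset) where

  private
    n = size P

  open IsPartialOrder (isPartialOrder P)
    using () renaming (refl to ⊑-refl; trans to ⊑-trans; antisym to ⊑-antisym)

  infix 4 _⊑_ _⊏_ _⊑?_ _⊏?_

  _⊑_ _⊏_ : Fin n → Fin n → Set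
  _⊑_ = _≼_ P
  x ⊏ y = x ⊑ y × x ≢ y

  _⊑?_ : ∀ x y → Dec (x ⊑ y)
  _⊑?_ = _≼?_ P

  _⊏?_ : ∀ x y → Dec (x ⊏ y)
  x ⊏? y = x ⊑? y ×-dec ¬? (x ≟ y)

  ⊏⇒⋣ : ∀ {x y} → x ⊏ y → ¬ y ⊑ x
  ⊏⇒⋣ (x⊑y , x≢y) y⊑x = x≢y (⊑-antisym x⊑y y⊑x)

  unionSize≤ : ∀ {m} (S : Fin n → Subset m) {W} → (∀ x → S x ⊆ W) → unionSize P S ≤ ∣ W ∣
  unionSize≤ S S⊆W = p⊆q⇒∣p∣≤∣q∣ λ e∈ → let x , e∈Sx = ∈⋃⁻ S e∈ in S⊆W x e∈Sx

  down : Fin n → Subset n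
  down x = comprehension (λ z → z ⊑? x)

  ∈-down⁺ : ∀ {x z} → z ⊑ x → z ∈ down x
  ∈-down⁺ {x} = ∈-comprehension⁺ (λ z → z ⊑? x)

  ∈-down⁻ : ∀ {x z} → z ∈ down x → z ⊑ x
  ∈-down⁻ {x} = ∈-comprehension⁻ (λ z → z ⊑? x)

  down-isInclRep : IsInclRep P n down
  down-isInclRep x y = (λ x⊑y z∈ → ∈-down⁺ (⊑-trans (∈-down⁻ z∈) x⊑y)) , (λ ⊆′ → ∈-down⁻ (⊆′ (∈-down⁺ ⊑-refl)))

  -- A representation whose sets have size at most h can be made to use fewer than ∣P∣ points as soon as some
  -- principal down-set has more than h elements. Call (X , N) a deficient pair if S x ⊆ N for x ∈ X and
  -- ∣N∣ < ∣X∣. Starting from (down y , S y), enlarge it by (down z , S z) as long as this adds more to X than to N;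
  -- then z ↦ (S z ∩ N) ⊎ (down z ─ X) is the required representation.
  module _ {m h : ℕ} (S : Fin n → Subset m) (rep : IsInclRep P m S) (bounded : Bounded P S h) where

    Economical : Set
    Economical = Σ ℕ λ m′ → Σ (Fin n → Subset m′) λ S′ → IsInclRep P m′ S′ × Bounded P S′ h × unionSize P S′ < n

    saturate : ∀ k (X : Subset n) (N : Subset m) → n < k + ∣ X ∣ → (∀ {x} → x ∈ X → S x ⊆ N) → ∣ N ∣ < ∣ X ∣ →
               Economical
    -- Fuel: `X` gains an element in each round, and `∣ X ∣` cannot exceed `n`.
    saturate zero    X N n<∣X∣ _ _ = contradiction (∣p∣≤n X) (<⇒≱ n<∣X∣)
    saturate (suc k) X N fuel S⊆N deficient with all? (λ z → ∣ down z ─ X ∣ ≤? ∣ S z ─ N ∣)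
    ... | no ¬tight with ¬∀⟶∃¬ n _ (λ z → ∣ down z ─ X ∣ ≤? ∣ S z ─ N ∣) ¬tight
    ...   | z , z≰ = saturate k (X ∪ down z) (N ∪ S z)
        (<-≤-trans fuel (≤-trans (≤-reflexive (sym (+-suc k ∣ X ∣))) (+-monoʳ-≤ k grows)))
        S∪⊆
        (subst₂ _<_ (sym (∣p∪q∣≡∣p∣+∣q─p∣ N (S z))) (sym (∣p∪q∣≡∣p∣+∣q─p∣ X (down z)))
          (+-mono-< deficient (≰⇒> z≰)))
      where
      grows : suc ∣ X ∣ ≤ ∣ X ∪ down z ∣
      grows = begin
        suc ∣ X ∣              ≡⟨ +-comm 1 ∣ X ∣ ⟩
        ∣ X ∣ + 1              ≤⟨ +-monoʳ-≤ ∣ X ∣ (≤-trans (s≤s z≤n) (≰⇒> z≰)) ⟩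
        ∣ X ∣ + ∣ down z ─ X ∣ ≡⟨ ∣p∪q∣≡∣p∣+∣q─p∣ X (down z) ⟨
        ∣ X ∪ down z ∣         ∎
        where open ≤-Reasoning
      S∪⊆ : ∀ {x} → x ∈ X ∪ down z → S x ⊆ N ∪ S z
      S∪⊆ {x} x∈ e∈ with x∈p∪q⁻ X (down z) x∈
      ... | inj₁ x∈X = x∈p∪q⁺ (inj₁ (S⊆N x∈X e∈))
      ... | inj₂ x∈z = x∈p∪q⁺ {p = N} (inj₂ (proj₁ (rep x z) (∈-down⁻ x∈z) e∈))
    saturate (suc k) X N fuel S⊆N deficient | yes tight = m + n , T , T-rep , T-bounded , T-small
      where
      T : Fin n → Subset (m + n)
      T z = (S z ∩ N) ++ (down z ─ X)
      T-rep : IsInclRep P (m + n) T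
      T-rep x y = fwd , bwd
        where
        fwd : x ⊑ y → T x ⊆ T y
        fwd x⊑y = ++-⊆⁺
          (λ e∈ → let e∈S , e∈N = x∈p∩q⁻ (S x) N e∈ in x∈p∩q⁺ (proj₁ (rep x y) x⊑y e∈S , e∈N))
          (λ e∈ → x∈p∧x∉q⇒x∈p─q (proj₁ (down-isInclRep x y) x⊑y (p─q⊆p (down x) X e∈)) (x∈p─q⇒x∉q (down x) X e∈))
        bwd : T x ⊆ T y → x ⊑ y
        -- For `x ∈ X` all of `S x` lies in `N`, so the first part decides; otherwise `x` itself is
        -- a point of the second part.
        bwd T⊆ with ++-⊆⁻ (S x ∩ N) (S y ∩ N) T⊆ | x ∈? X
        ... | S⊆ , _ | yes x∈X = proj₂ (rep x y) λ e∈ → p∩q⊆p (S y) N (S⊆ (x∈p∩q⁺ (e∈ , S⊆N x∈X e∈)))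
        ... | _ , D⊆ | no x∉X  = ∈-down⁻ (p─q⊆p (down y) X (D⊆ (x∈p∧x∉q⇒x∈p─q (∈-down⁺ ⊑-refl) x∉X)))
      T-bounded : Bounded P T h
      T-bounded z = begin
        ∣ T z ∣                         ≡⟨ ∣p++q∣≡∣p∣+∣q∣ (S z ∩ N) (down z ─ X) ⟩
        ∣ S z ∩ N ∣ + ∣ down z ─ X ∣   ≤⟨ +-monoʳ-≤ ∣ S z ∩ N ∣ (tight z) ⟩
        ∣ S z ∩ N ∣ + ∣ S z ─ N ∣      ≡⟨ ∣p∩q∣+∣p─q∣≡∣p∣ (S z) N ⟩
        ∣ S z ∣                         ≤⟨ bounded z ⟩
        h                                ∎
        where open ≤-Reasoning
      T-small : unionSize P T < n
      T-small = begin-strict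
        unionSize P T          ≤⟨ unionSize≤ T (λ z → ++-⊆⁺ (p∩q⊆q (S z) N) (λ e∈ → x∉p⇒x∈∁p (x∈p─q⇒x∉q (down z) X e∈))) ⟩
        ∣ N ++ ∁ X ∣           ≡⟨ ∣p++q∣≡∣p∣+∣q∣ N (∁ X) ⟩
        ∣ N ∣ + ∣ ∁ X ∣        <⟨ +-monoˡ-< ∣ ∁ X ∣ deficient ⟩
        ∣ X ∣ + ∣ ∁ X ∣        ≡⟨ cong (∣ X ∣ +_) (∣∁p∣≡n∸∣p∣ X) ⟩
        ∣ X ∣ + (n ∸ ∣ X ∣)    ≡⟨ m+[n∸m]≡n (∣p∣≤n X) ⟩
        n                        ∎
        where open ≤-Reasoning

    economical : ∀ y → h < ∣ down y ∣ → Economical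
    economical y h<∣y∣ = saturate (suc n) (down y) (S y) (s≤s (m≤m+n n ∣ down y ∣))
      (λ x∈ → proj₁ (rep _ y) (∈-down⁻ x∈)) (≤-<-trans (bounded y) h<∣y∣)

  tallest : ∃ λ y → ∀ x → ∣ down x ∣ ≤ ∣ down y ∣
  tallest with extremum {Q = λ _ → 0 ≤ 0} (λ _ → yes z≤n) {λ x y → ∣ down x ∣ ≤ ∣ down y ∣} (λ _ → ≤-refl) ≤-trans
               (λ x y _ _ → ≤-total ∣ down x ∣ ∣ down y ∣) (F.fromℕ< (nonEmpty P) , z≤n)
  ... | y , _ , best = y , λ x → best x z≤n

  -- By `economical`, a representation with smaller sets would yield one that violates the lower
  -- bound. Hence the largest size of a principal down-set is ch(P), and the down-sets attain `n`.
  isCw⁺ : (∀ m (S : Fin n → Subset m) → IsInclRep P m S → Bounded P S ∣ down (proj₁ tallest) ∣ → n ≤ unionSize P S) →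
          IsCw P n
  isCw⁺ lower = ∣ down y ∣ , ((n , down , down-isInclRep , best) , ch-lower) ,
                (n , down , down-isInclRep , best , union≡n) , lower
    where
    y = proj₁ tallest
    best = proj₂ tallest
    ch-lower : ∀ h′ m (S : Fin n → Subset m) → IsInclRep P m S → Bounded P S h′ → ∣ down y ∣ ≤ h′
    ch-lower h′ m S rep bounded with ∣ down y ∣ ≤? h′
    ... | yes ≤h′ = ≤h′
    ... | no  ≰h′ with economical S rep bounded y (≰⇒> ≰h′)
    ...   | m′ , S′ , rep′ , bounded′ , small =
      contradiction (lower m′ S′ rep′ λ x → ≤-trans (bounded′ x) (<⇒≤ (≰⇒> ≰h′))) (<⇒≱ small)
    union≡n : unionSize P down ≡ n
    union≡n = ≤-antisym (∣p∣≤n (⋃ (tabulateL down))) (subst (_≤ unionSize P down) (∣⊤∣≡n n)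
      (p⊆q⇒∣p∣≤∣q∣ {p = ⊤} λ {x} _ → ∈⋃⁺ down x (∈-down⁺ ⊑-refl)))

  -- Either every down-set has size at most ch(P), and `S` competes in the definition of cw; or some
  -- down-set is larger, and `economical` already refutes cw(P) = |P|.
  isCw⁻ : IsCw P n → ∀ {m} (S : Fin n → Subset m) → IsInclRep P m S → (∀ x → ∃ λ y → ∣ S x ∣ ≤ ∣ down y ∣) →
          n ≤ unionSize P S
  isCw⁻ (h , ((m₀ , S₀ , rep₀ , bounded₀) , _) , _ , lower) {m} S rep low with all? (λ y → ∣ down y ∣ ≤? h)
  ... | yes ≤h = lower m S rep λ x → let y , ≤y = low x in ≤-trans ≤y (≤h y)
  ... | no ¬≤h with ¬∀⟶∃¬ n _ (λ y → ∣ down y ∣ ≤? h) ¬≤h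
  ...   | y , y≰h with economical S₀ rep₀ bounded₀ y (≰⇒> y≰h)
  ...     | m′ , S′ , rep′ , bounded′ , small = contradiction (lower m′ S′ rep′ bounded′) (<⇒≱ small)

  -- Local modifications of the representation by down-sets

  Improvement : Set
  Improvement = Σ (Fin n) λ d → Σ (Fin n → Subset n) λ S →
    IsInclRep P n S × (∀ x → ∃ λ y → ∣ S x ∣ ≤ ∣ down y ∣) × (∀ x → d ∉ S x)

  isCw⇒¬Improvement : IsCw P n → ¬ Improvement
  isCw⇒¬Improvement cw (d , S , rep , low , d∉) = <⇒≱ small (isCw⁻ cw S rep low)
    where
    small : unionSize P S < n
    small = ≤-<-trans (unionSize≤ S {⊤ - d} λ x e∈ → x∈p∧x≢y⇒x∈p-y ∈⊤ λ { refl → d∉ x e∈ })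
                      (subst (∣ ⊤ - d ∣ <_) (∣⊤∣≡n n) (x∈p⇒∣p-x∣<∣p∣ (∈⊤ {x = d})))

  -- Without the point `m` only the separation of `m` from elements not above it is at risk, and
  -- there a point strictly below `m` takes over.
  remove : ∀ m → (∀ y → ¬ m ⊑ y → ∃ λ z → z ⊏ m × ¬ z ⊑ y) → Improvement
  remove m removable = m , S , rep ,
    (λ x → x , ∣p─q∣≤∣p∣ (down x) ⁅ m ⁆) , λ x → ∉-minus (down x) m
    where
    S : Fin n → Subset n
    S x = down x - m
    S⁺ : ∀ {x z} → z ⊑ x → z ≢ m → z ∈ S x
    S⁺ z⊑x z≢m = x∈p∧x≢y⇒x∈p-y (∈-down⁺ z⊑x) z≢m
    S⁻ : ∀ {x z} → z ∈ S x → z ⊑ x × z ≢ m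
    S⁻ {x} z∈ = let z∈x , z≢m = ∈-minus⁻ (down x) z∈ in ∈-down⁻ z∈x , z≢m
    rep : IsInclRep P n S
    rep x y = (λ x⊑y z∈ → let z⊑x , z≢m = S⁻ z∈ in S⁺ (⊑-trans z⊑x x⊑y) z≢m) , bwd
      where
      bwd : S x ⊆ S y → x ⊑ y
      bwd S⊆ with x ⊑? y | x ≟ m
      ... | yes x⊑y | _      = x⊑y
      ... | no _    | no x≢m = proj₁ (S⁻ (S⊆ (S⁺ ⊑-refl x≢m)))
      ... | no x⋢y  | yes refl with removable y x⋢y
      ...   | z , (z⊑x , z≢x) , z⋢y = contradiction (proj₁ (S⁻ (S⊆ (S⁺ z⊑x z≢x)))) z⋢y

  -- In the representation by down-sets, replace the point s i of the set of s i by the points p i and q i, and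
  -- delete the point s i₀ everywhere.
  module Recolouring {r} (s p q : Fin r → Fin n) (i₀ : Fin r) where

    data Coloured (i : Fin r) (e : Fin n) : Set where
      below  : e ⊏ s i → Coloured i e
      left   : e ≡ p i → Coloured i e
      right  : e ≡ q i → Coloured i e

    colour : Fin r → Subset n
    colour i = ((down (s i) - s i) ∪ ⁅ p i ⁆) ∪ ⁅ q i ⁆

    colour⁺ : ∀ {i e} → Coloured i e → e ∈ colour i
    colour⁺ (below (e⊑ , e≢)) = x∈p∪q⁺ (inj₁ (x∈p∪q⁺ (inj₁ (x∈p∧x≢y⇒x∈p-y (∈-down⁺ e⊑) e≢))))
    colour⁺ {i} (left refl)   = x∈p∪q⁺ (inj₁ (x∈p∪q⁺ {p = down (s i) - s i} (inj₂ (x∈⁅x⁆ _))))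
    colour⁺ {i} (right refl)  = x∈p∪q⁺ {p = (down (s i) - s i) ∪ ⁅ p i ⁆} (inj₂ (x∈⁅x⁆ _))

    colour⁻ : ∀ i {e} → e ∈ colour i → Coloured i e
    colour⁻ i e∈ with x∈p∪q⁻ ((down (s i) - s i) ∪ ⁅ p i ⁆) ⁅ q i ⁆ e∈
    ... | inj₂ e∈q = right (x∈⁅y⁆⇒x≡y (q i) e∈q)
    ... | inj₁ e∈′ with x∈p∪q⁻ (down (s i) - s i) ⁅ p i ⁆ e∈′
    ...   | inj₂ e∈p = left (x∈⁅y⁆⇒x≡y (p i) e∈p)
    ...   | inj₁ e∈D = let e∈↓ , e≢ = ∈-minus⁻ (down (s i)) e∈D in below (∈-down⁻ e∈↓ , e≢)

    Plain : Fin n → Set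
    Plain x = ∀ i → s i ≢ x

    -- The `s i` form an antichain. Plain elements keep their down-sets without `s i₀`, so two of
    -- them are separated as before; the three `sep` hypotheses treat the other kinds of pairs. A
    -- plain `x` can fail to separate itself from `s i` only if it is `p i` or `q i`, hence the form
    -- of `sep-ps`.
    recolour : (∀ i j → s i ⊑ s j → i ≡ j) →
               (∀ i → p i ≢ s i₀) → (∀ i → q i ≢ s i₀) →
               (∀ i y → s i ⊏ y → p i ⊑ y × q i ⊑ y) →
               (∀ i j → i ≢ j → ∃ λ e → Coloured i e × ¬ Coloured j e) →
               (∀ i y → Plain y → ¬ s i ⊑ y → ∃ λ e → Coloured i e × ¬ e ⊑ y) →
               (∀ i x → Plain x → x ≡ p i ⊎ x ≡ q i → ∃ λ z → z ⊏ x × z ≢ s i₀ × ¬ Coloured i z) →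
               (∀ i → ∃ λ y → ∣ colour i ∣ ≤ ∣ down y ∣) →
               Improvement
    recolour anti p≢d q≢d above sep-ss sep-sp sep-ps low = d , S , rep , S-low , d∉S
      where
      d = s i₀

      S′ : ∀ x → Dec (∃ λ i → s i ≡ x) → Subset n
      S′ x (yes (i , _)) = colour i
      S′ x (no _)        = down x - d

      special? : ∀ x → Dec (∃ λ i → s i ≡ x)
      special? x = any? (λ i → s i ≟ x)

      S : Fin n → Subset n
      S x = S′ x (special? x)

      S-low : ∀ x → ∃ λ y → ∣ S x ∣ ≤ ∣ down y ∣
      S-low x with special? x
      ... | yes (i , _) = low i
      ... | no _        = x , ∣p─q∣≤∣p∣ (down x) ⁅ d ⁆

      d-uncoloured : ∀ i → ¬ Coloured i d
      d-uncoloured i (below (d⊑ , d≢)) = d≢ (cong s (anti i₀ i d⊑))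
      d-uncoloured i (left eq)         = p≢d i (sym eq)
      d-uncoloured i (right eq)        = q≢d i (sym eq)

      d∉S : ∀ x → d ∉ S x
      d∉S x with special? x
      ... | yes (i , _) = d-uncoloured i ∘ colour⁻ i
      ... | no _        = ∉-minus (down x) d

      rep : IsInclRep P n S
      rep x y = fwd , bwd
        where
        fwd : x ⊑ y → S x ⊆ S y
        fwd x⊑y with x ≟ y
        ... | yes refl = id
        ... | no x≢y with special? x | special? y
        ...   | yes (i , refl) | yes (j , refl) = contradiction (cong s (anti i j x⊑y)) x≢y
        ...   | no _ | yes (j , refl) = λ e∈ →
          let e∈x , _ = ∈-minus⁻ (down x) e∈
              e⊑x = ∈-down⁻ e∈x
          in colour⁺ (below (⊑-trans e⊑x x⊑y , λ { refl → x≢y (⊑-antisym x⊑y e⊑x) }))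
        ...   | no _ | no _ = λ e∈ →
          let e∈x , e≢d = ∈-minus⁻ (down x) e∈
          in x∈p∧x≢y⇒x∈p-y (∈-down⁺ (⊑-trans (∈-down⁻ e∈x) x⊑y)) e≢d
        ...   | yes (i , refl) | no _ = λ e∈ →
          let c = colour⁻ i e∈ in
          x∈p∧x≢y⇒x∈p-y (∈-down⁺ (up c)) λ { refl → d-uncoloured i c }
          where
          up : ∀ {e} → Coloured i e → e ⊑ y
          up (below (e⊑ , _)) = ⊑-trans e⊑ x⊑y
          up (left refl)      = proj₁ (above i y (x⊑y , x≢y))
          up (right refl)     = proj₂ (above i y (x⊑y , x≢y))

        bwd : S x ⊆ S y → x ⊑ y
        bwd S⊆ with x ⊑? y
        ... | yes x⊑y = x⊑y
        ... | no x⋢y with special? x | special? y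
        ...   | yes (i , refl) | yes (j , refl) =
          let e , c , ¬c = sep-ss i j (λ { refl → x⋢y ⊑-refl }) in contradiction (colour⁻ j (S⊆ (colour⁺ c))) ¬c
        ...   | yes (i , refl) | no plain =
          let e , c , e⋢y = sep-sp i y (λ j eq → plain (j , eq)) x⋢y
          in contradiction (∈-down⁻ (proj₁ (∈-minus⁻ (down y) (S⊆ (colour⁺ c))))) e⋢y
        ...   | no plain | no _ =
          ∈-down⁻ (proj₁ (∈-minus⁻ (down y) (S⊆ (x∈p∧x≢y⇒x∈p-y (∈-down⁺ ⊑-refl) λ eq → plain (i₀ , sym eq)))))
        ...   | no plain | yes (j , refl) with colour⁻ j (S⊆ (x∈p∧x≢y⇒x∈p-y (∈-down⁺ ⊑-refl) λ eq → plain (i₀ , sym eq)))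
        ...     | below (x⊑y , _) = x⊑y
        ...     | left eq  = ⊥-elim (absurd (inj₁ eq))
          where
          absurd : x ≡ p j ⊎ x ≡ q j → ⊥
          absurd eq = let z , (z⊑x , _) , z≢d , ¬c = sep-ps j x (λ i e → plain (i , e)) eq
                      in ¬c (colour⁻ j (S⊆ (x∈p∧x≢y⇒x∈p-y (∈-down⁺ z⊑x) z≢d)))
        ...     | right eq = ⊥-elim (absurd (inj₂ eq))
          where
          absurd : x ≡ p j ⊎ x ≡ q j → ⊥
          absurd eq = let z , (z⊑x , _) , z≢d , ¬c = sep-ps j x (λ i e → plain (i , e)) eq
                      in ¬c (colour⁻ j (S⊆ (x∈p∧x≢y⇒x∈p-y (∈-down⁺ z⊑x) z≢d)))

    ∣colour∣≤ : ∀ i → ∣ colour i ∣ ≤ 2 + ∣ down (s i) - s i ∣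
    ∣colour∣≤ i = ≤-trans (∣p∪⁅x⁆∣≤1+∣p∣ ((down (s i) - s i) ∪ ⁅ p i ⁆) (q i)) (s≤s (∣p∪⁅x⁆∣≤1+∣p∣ (down (s i) - s i) (p i)))

  -- The preorder given by inclusion of the strict down-sets D.
  Below : Fin n → Fin n → Set
  Below b c = ∀ z → z ⊏ b → z ⊏ c

  Below? : ∀ b c → Dec (Below b c)
  Below? b c = all? (λ z → z ⊏? b →-dec z ⊏? c)

  ¬Below⇒witness : ∀ {b c} → ¬ Below b c → ∃ λ z → z ⊏ b × ¬ z ⊏ c
  ¬Below⇒witness {b} {c} ¬bc with ¬∀⟶∃¬ n _ (λ z → z ⊏? b →-dec z ⊏? c) ¬bc
  ... | z , ¬imp = z , decidable-stable (z ⊏? b) (λ ¬zb → ¬imp λ zb → contradiction zb ¬zb) , λ zc → ¬imp λ _ → zc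

  -- D(c) has a point outside D(b), and `c` is one more; so a set made of D(b) and two further
  -- points still respects the size bound.
  2+∣D∣≤ : ∀ {b c} → Below b c → ¬ Below c b → 2 + ∣ down b - b ∣ ≤ ∣ down c ∣
  2+∣D∣≤ {b} {c} bc ¬cb =
    let z , (z⊑c , z≢c) , ¬zb = ¬Below⇒witness ¬cb in
    ≤-trans (s≤s (p⊂q⇒∣p∣<∣q∣ {p = down b - b} {q = down c - c}
      ( (λ e∈ → let e∈b , e≢b = ∈-minus⁻ (down b) e∈
                    e⊑c , e≢c = bc _ (∈-down⁻ e∈b , e≢b)
                in x∈p∧x≢y⇒x∈p-y (∈-down⁺ e⊑c) e≢c)
      , z , x∈p∧x≢y⇒x∈p-y (∈-down⁺ z⊑c) z≢c
      , λ z∈ → let z∈b , z≢b = ∈-minus⁻ (down b) z∈ in ¬zb (∈-down⁻ z∈b , z≢b))))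
      (x∈p⇒∣p-x∣<∣p∣ (∈-down⁺ ⊑-refl))

  irremovable⇒ : ∀ {c} → ¬ (∀ y → ¬ c ⊑ y → ∃ λ z → z ⊏ c × ¬ z ⊑ y) → ∃ λ y → ¬ c ⊑ y × (∀ z → z ⊏ c → z ⊑ y)
  irremovable⇒ {c} ¬rem with ¬∀⟶∃¬ n _ (λ y → ¬? (c ⊑? y) →-dec any? (λ z → z ⊏? c ×-dec ¬? (z ⊑? y))) ¬rem
  ... | y , ¬imp = y , (λ c⊑y → ¬imp λ c⋢y → contradiction c⊑y c⋢y) ,
    λ z z⊏c → decidable-stable (z ⊑? y) λ z⋢y → ¬imp λ _ → z , z⊏c , z⋢y

  -- Maximal elements of a block; every outside element lies below or above all of it

  module Block (U : Sub P) (U? : Decidable U)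
               (interval : ∀ x → ¬ U x → (∀ u → U u → x ⊑ u) ⊎ (∀ u → U u → u ⊑ x)) where

    Max : Fin n → Set
    Max b = U b × (∀ y → U y → b ⊑ y → b ≡ y)

    Max? : Decidable Max
    Max? b = U? b ×-dec all? (λ y → U? y →-dec (b ⊑? y →-dec b ≟ y))

    vsum2 : ∀ {Low : Fin n → Set} → Decidable Low → (∃ λ x → U x × Low x) → (∃ λ y → U y × ¬ Low y) →
            (∀ x y → U x → U y → Low x → ¬ Low y → x ⊑ y) → IsVSum2On P U
    -- The colour `false` marks the lower part, hence the negation.
    vsum2 Low? (x , x∈ , lx) (y , y∈ , ¬ly) cut = (λ z → not (does (Low? z))) ,
      (x , x∈ , cong not (dec-true (Low? x) lx)) , (y , y∈ , cong not (dec-false (Low? y) ¬ly)) ,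
      λ x y x∈ y∈ cx cy → cut x y x∈ y∈ (low x cx) (high y cy)
      where
      low : ∀ x → not (does (Low? x)) ≡ false → _
      low x c with Low? x
      ... | yes l = l
      high : ∀ x → not (does (Low? x)) ≡ true → ¬ _
      high x c with Low? x
      ... | no ¬l = ¬l

    max-⋢ : ∀ {b c} → Max b → U c → b ≢ c → ¬ b ⊑ c
    max-⋢ (_ , mx) c b≢c b⊑c = b≢c (mx _ c b⊑c)

    -- Such a `y` is outside `U` by maximality of `b`, and it cannot be on the lower side.
    max-⊏ : ∀ {b y} → Max b → b ⊏ y → ∀ u → U u → u ⊑ y
    max-⊏ {b} {y} (b∈ , mx) (b⊑y , b≢y) with U? y
    ... | yes y∈ = contradiction (mx y y∈ b⊑y) b≢y
    ... | no y∉ with interval y y∉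
    ...   | inj₂ up = up
    ...   | inj₁ dn = contradiction (⊑-antisym b⊑y (dn b b∈)) b≢y

    -- This lets the points of two maximal elements replace the own point of another: a principal
    -- down-set containing both belongs to an upper bound of `U`.
    max-⊑⊑ : ∀ {b c y} → Max b → Max c → b ≢ c → b ⊑ y → c ⊑ y → ∀ u → U u → u ⊑ y
    max-⊑⊑ {b} {c} {y} mb mc b≢c b⊑y c⊑y with b ≟ y
    ... | yes refl = contradiction c⊑y (max-⋢ mc (proj₁ mb) (b≢c ∘ sym))
    ... | no b≢y   = max-⊏ mb (b⊑y , b≢y)

    max-witness : ∀ {b c} → Max b → Max c → ¬ Below b c → ∃ λ z → z ⊏ b × ¬ z ⊑ c
    max-witness {b} {c} mb mc ¬bc with ¬Below⇒witness ¬bc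
    ... | z , z⊏b , ¬z⊏c = z , z⊏b , λ z⊑c → ¬z⊏c (z⊑c , λ { refl → proj₂ z⊏b (proj₂ mc _ (proj₁ mb) (proj₁ z⊏b)) })

    -- Going up strictly enlarges the down-set, so an element of `U` above `u` with the largest
    -- down-set is maximal.
    max-above : ∀ u → U u → ∃ λ b → Max b × u ⊑ b
    max-above u u∈ with extremum (λ b → U? b ×-dec u ⊑? b) {λ x y → ∣ down x ∣ ≤ ∣ down y ∣} (λ _ → ≤-refl) ≤-trans
                          (λ x y _ _ → ≤-total ∣ down x ∣ ∣ down y ∣) (u , u∈ , ⊑-refl)
    ... | b , (b∈ , u⊑b) , best = b , (b∈ , mx) , u⊑b
      where
      mx : ∀ y → U y → b ⊑ y → b ≡ y
      mx y y∈ b⊑y = decidable-stable (b ≟ y) λ b≢y → <⇒≱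
        (p⊂q⇒∣p∣<∣q∣ {p = down b} {q = down y}
          (proj₁ (down-isInclRep b y) b⊑y , y , ∈-down⁺ ⊑-refl , λ y∈b → b≢y (⊑-antisym b⊑y (∈-down⁻ y∈b))))
        (best y (y∈ , ⊑-trans u⊑b b⊑y))

    -- b and c can share the ground point b.
    merge : ∀ {b c} → Max b → Max c → ¬ Below b c → ¬ Below c b → Improvement
    merge {b} {c} mb mc ¬bc ¬cb = recolour
      (λ { zero zero _ → refl }) (λ _ → b≢c) (λ _ → b≢c)
      (λ _ y c⊏y → let b⊑y = max-⊏ mc c⊏y b (proj₁ mb) in b⊑y , b⊑y)
      (λ { zero zero 0≢0 → contradiction refl 0≢0 })
      sep-sp sep-ps
      -- `p` and `q` are both `b`, so the new set of `c` has at most one point beyond D(c) and is no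
      -- larger than its down-set.
      (λ i → c , ≤-trans (p⊆q⇒∣p∣≤∣q∣ {q = (down c - c) ∪ ⁅ b ⁆} (absorb i))
                   (≤-trans (∣p∪⁅x⁆∣≤1+∣p∣ (down c - c) b) (x∈p⇒∣p-x∣<∣p∣ (∈-down⁺ ⊑-refl))))
      where
      open Recolouring {1} (λ _ → c) (λ _ → b) (λ _ → b) zero
      b≢c : b ≢ c
      b≢c refl = ¬bc λ z → id
      absorb : ∀ i → colour i ⊆ (down c - c) ∪ ⁅ b ⁆
      absorb i e∈ with x∈p∪q⁻ ((down c - c) ∪ ⁅ b ⁆) ⁅ b ⁆ e∈
      ... | inj₁ e∈′ = e∈′
      ... | inj₂ e∈b = x∈p∪q⁺ {p = down c - c} (inj₂ e∈b)
      sep-sp : ∀ i y → Plain y → ¬ c ⊑ y → ∃ λ e → Coloured i e × ¬ e ⊑ y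
      sep-sp i y _ c⋢y with b ⊑? y | b ≟ y
      ... | no b⋢y | _ = b , left refl , b⋢y
      ... | yes _ | yes refl = let z , z⊏c , z⋢b = max-witness mc mb ¬cb in z , below z⊏c , z⋢b
      ... | yes b⊑y | no b≢y = contradiction (max-⊏ mb (b⊑y , b≢y) c (proj₁ mc)) c⋢y
      sep-ps : ∀ i x → Plain x → x ≡ b ⊎ x ≡ b → ∃ λ z → z ⊏ x × z ≢ c × ¬ Coloured i z
      sep-ps i x _ x≡ with [ id , id ]′ x≡
      ... | refl with max-witness mb mc ¬bc
      ...   | z , z⊏b , z⋢c = z , z⊏b , (λ { refl → z⋢c ⊑-refl }) ,
        λ { (below (z⊑c , _)) → z⋢c z⊑c ; (left refl) → proj₂ z⊏b refl ; (right refl) → proj₂ z⊏b refl }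

    -- The non-inclusion hypothesis concerns the maximal elements that keep their sets: one of them
    -- may be `p i` or `q i`, and then a point strictly below it must tell it from `σ i`.
    recolourMax : ∀ {v r σ p q i₀} → Scheme v r σ p q i₀ → (g : Fin v → Fin n) →
      (∀ k → Max (g k)) → Injective _≡_ _≡_ g →
      (∀ k → (∀ i → σ i ≢ k) → ∀ i → ¬ Below (g k) (g (σ i))) →
      (∀ i → ∃ λ y → 2 + ∣ down (g (σ i)) - g (σ i) ∣ ≤ ∣ down y ∣) →
      Improvement
    recolourMax {v} {r} {σ} {p} {q} {i₀} sc g mx g-inj ¬below low = recolour
      (λ i j gi⊑gj → σ-injective i j (g-inj (proj₂ (mx (σ i)) _ (proj₁ (mx (σ j))) gi⊑gj)))
      (λ i → p≢d i ∘ g-inj) (λ i → q≢d i ∘ g-inj)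
      (λ i y gi⊏y → let up = max-⊏ (mx (σ i)) gi⊏y in up _ (proj₁ (mx (p i))) , up _ (proj₁ (mx (q i))))
      sep-ss sep-sp sep-ps
      (λ i → let y , ≤y = low i in y , ≤-trans (∣colour∣≤ i) ≤y)
      where
      open Scheme sc
      open Recolouring (g ∘ σ) (g ∘ p) (g ∘ q) i₀
      max-⊀ : ∀ k l → ¬ g k ⊏ g l
      max-⊀ k l (⊑′ , ≢′) = ≢′ (proj₂ (mx k) _ (proj₁ (mx l)) ⊑′)
      sep-ss : ∀ i j → i ≢ j → ∃ λ e → Coloured i e × ¬ Coloured j e
      sep-ss i j i≢j with separating i j i≢j
      ... | k , k∈ , k≢p , k≢q = g k , [ left ∘ cong g , right ∘ cong g ]′ k∈ ,
        λ { (below ⊏′) → max-⊀ k (σ j) ⊏′ ; (left eq) → k≢p (g-inj eq) ; (right eq) → k≢q (g-inj eq) }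
      sep-sp : ∀ i y → Plain y → ¬ g (σ i) ⊑ y → ∃ λ e → Coloured i e × ¬ e ⊑ y
      sep-sp i y _ ⋢y with g (p i) ⊑? y | g (q i) ⊑? y
      ... | no p⋢y | _ = _ , left refl , p⋢y
      ... | yes _ | no q⋢y = _ , right refl , q⋢y
      ... | yes p⊑y | yes q⊑y =
        contradiction (max-⊑⊑ (mx (p i)) (mx (q i)) (p≢q i ∘ g-inj) p⊑y q⊑y _ (proj₁ (mx (σ i)))) ⋢y
      sep-ps : ∀ i x → Plain x → x ≡ g (p i) ⊎ x ≡ g (q i) → ∃ λ z → z ⊏ x × z ≢ g (σ i₀) × ¬ Coloured i z
      sep-ps i x plain x≡ with lift x≡
        where
        lift : x ≡ g (p i) ⊎ x ≡ g (q i) → ∃ λ k → x ≡ g k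
        lift = [ p i ,_ , q i ,_ ]′
      ... | k , refl with max-witness (mx k) (mx (σ i)) (¬below k (λ j σj≡k → plain j (cong g σj≡k)) i)
      ...   | z , z⊏x , z⋢ = z , z⊏x ,
        (λ { refl → max-⊀ (σ i₀) k z⊏x }) ,
        λ { (below (z⊑ , _)) → z⋢ z⊑ ; (left refl) → max-⊀ (p i) k z⊏x ; (right refl) → max-⊀ (q i) k z⊏x }

    -- Classification of an indecomposable block with two incomparable elements

    module Classify (¬imp : ¬ Improvement) (indecomposable : ¬ IsVSum2On P U)
                    (u₀ v₀ : Fin n) (u₀∈ : U u₀) (v₀∈ : U v₀) (u₀⋢v₀ : ¬ u₀ ⊑ v₀) (v₀⋢u₀ : ¬ v₀ ⊑ u₀) where

      comparable : ∀ b c → Max b → Max c → Below b c ⊎ Below c b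
      comparable b c mb mc with Below? b c | Below? c b
      ... | yes bc | _ = inj₁ bc
      ... | no _ | yes cb = inj₂ cb
      ... | no ¬bc | no ¬cb = contradiction (merge mb mc ¬bc ¬cb) ¬imp

      some-max : ∃ Max
      some-max = let b , mb , _ = max-above u₀ u₀∈ in b , mb

      low? : ∀ b → Decidable (λ x → x ⊏ b)
      low? b x = x ⊏? b

      module Antichain (below-all : ∀ b c → Max b → Max c → Below b c) where

        -- As all maximal elements have the same D, a non-maximal element would lie below each of
        -- them, and the block would be a vertical sum.
        all-max : ∀ u → U u → Max u
        all-max u u∈ with Max? u
        ... | yes mu = mu
        ... | no ¬mu = contradiction
          (vsum2 {Low = λ x → ¬ Max x} (¬? ∘ Max?) (u , u∈ , ¬mu)
            (proj₁ some-max , proj₁ (proj₂ some-max) , λ ¬m → ¬m (proj₂ some-max))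
            λ x y x∈ y∈ ¬mx ¬¬my →
              let b , mb , x⊑b = max-above x x∈
              in proj₁ (below-all b y mb (decidable-stable (Max? y) ¬¬my) x (x⊑b , λ x≡b → ¬mx (subst Max (sym x≡b) mb))))
          indecomposable

        inA : InA P U
        inA with enumerate U?
        ... | k , f , f∈ , onto , inj = k , 2≤k k f (onto u₀ u₀∈) (onto v₀ v₀∈) , f , f∈ , onto , inj ,
          λ i j → (λ { refl → ⊑-refl }) , λ fi⊑fj → inj (proj₂ (all-max (f i) (f∈ i)) (f j) (f∈ j) fi⊑fj)
          where
          2≤k : ∀ k (f : Fin k → Fin n) → (∃ λ j → f j ≡ u₀) → (∃ λ j → f j ≡ v₀) → 2 ≤ k
          2≤k (suc zero)    _ (zero , refl) (zero , refl) = contradiction ⊑-refl u₀⋢v₀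
          2≤k (suc (suc _)) _ _             _             = s≤s (s≤s z≤n)

      module Main (br b₁ : Fin n) (mr : Max br) (m₁ : Max b₁) (¬r1 : ¬ Below br b₁)
                  (below-r : ∀ b → Max b → Below b br) (1-below : ∀ b → Max b → Below b₁ b) where

        b₁≢br : b₁ ≢ br
        b₁≢br refl = ¬r1 λ z → id

        -- If D(b) were not inside the smallest set D(b₁), then `oneOfThree` would let `b₁` trade
        -- its point for those of `b` and `br`. So all maximal elements but `br` have the same D.
        below-1 : ∀ b → Max b → b ≢ br → Below b b₁
        below-1 b mb b≢br with Below? b b₁
        ... | yes bb₁ = bb₁
        ... | no ¬bb₁ = contradiction
          (recolourMax oneOfThree g g-max g-inj ¬below (λ _ → br , 2+∣D∣≤ (1-below br mr) ¬r1)) ¬imp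
          where
          g : Fin 3 → Fin n
          g = lookup (b₁ ∷ b ∷ br ∷ [])
          g-max : ∀ k → Max (g k)
          g-max zero = m₁
          g-max (suc zero) = mb
          g-max (suc (suc zero)) = mr
          b₁≢b : b₁ ≢ b
          b₁≢b refl = ¬bb₁ λ z → id
          g-inj : Injective _≡_ _≡_ g
          g-inj {zero} {zero} _ = refl
          g-inj {suc zero} {suc zero} _ = refl
          g-inj {suc (suc zero)} {suc (suc zero)} _ = refl
          g-inj {zero} {suc zero} eq = contradiction eq b₁≢b
          g-inj {zero} {suc (suc zero)} eq = contradiction eq b₁≢br
          g-inj {suc zero} {zero} eq = contradiction (sym eq) b₁≢b
          g-inj {suc zero} {suc (suc zero)} eq = contradiction eq b≢br
          g-inj {suc (suc zero)} {zero} eq = contradiction (sym eq) b₁≢br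
          g-inj {suc (suc zero)} {suc zero} eq = contradiction (sym eq) b≢br
          ¬below : ∀ k → (∀ i → zero ≢ k) → ∀ i → ¬ Below (g k) b₁
          ¬below zero ≢k = contradiction refl (≢k zero)
          ¬below (suc zero) _ _ = ¬bb₁
          ¬below (suc (suc zero)) _ _ = ¬r1

        -- The descent from `br` so far: an up-closed chain among the elements of `U` below `br`,
        -- listed upwards from its least element `f zero`.
        record Tail : Set where
          field
            {m}       : ℕ
            f         : Fin (suc m) → Fin n
            f∈        : ∀ i → U (f i)
            f⊑br      : ∀ i → f i ⊑ br
            mono      : ∀ i j → i F.≤ j → f i ⊑ f j
            reflects  : ∀ i j → f i ⊑ f j → i F.≤ j
            cover     : ∀ u → U u → u ⊑ br → u ⊑ f zero ⊎ ∃ λ j → f j ≡ u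
            f⋢b₁      : ¬ f zero ⊑ b₁

        open Tail

        Bottom : Tail → Set
        Bottom t = ∀ z → U z → z ⊏ f t zero → z ⊑ b₁

        -- If the least element c of the tail is not removable, some y ⋣ c lies above all elements strictly below c; it
        -- turns out to be the unique lower cover of c and extends the tail.
        descend : ∀ k (t : Tail) → ∣ down (f t zero) ∣ < k → Σ Tail Bottom
        descend (suc k) t (s≤s fuel) with any? (λ z → U? z ×-dec z ⊏? f t zero ×-dec ¬? (z ⊑? b₁))
        ... | no none = t , λ z z∈ z⊏c → decidable-stable (z ⊑? b₁) λ z⋢b₁ → none (z , z∈ , z⊏c , z⋢b₁)
        ... | yes (z , z∈ , z⊏c , z⋢b₁) with all? (λ y → ¬? (f t zero ⊑? y) →-dec any? (λ z → z ⊏? f t zero ×-dec ¬? (z ⊑? y)))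
        ...   | yes removable = contradiction (remove (f t zero) removable) ¬imp
        ...   | no irremovable with irremovable⇒ irremovable
        ...     | y , c⋢y , D⊑y = descend k t′ (<-≤-trans (p⊂q⇒∣p∣<∣q∣ {p = down y} {q = down c}
            (proj₁ (down-isInclRep y c) (proj₁ y⊏c) , c , ∈-down⁺ ⊑-refl , c⋢y ∘ ∈-down⁻)) fuel)
          where
          c = f t zero
          z⊑y : z ⊑ y
          z⊑y = D⊑y z z⊏c
          y∈ : U y
          y∈ with U? y
          ... | yes y∈ = y∈
          ... | no y∉ with interval y y∉
          ...   | inj₁ dn = contradiction (subst U (⊑-antisym z⊑y (dn z z∈)) z∈) y∉
          ...   | inj₂ up = contradiction (up c (f∈ t zero)) c⋢y
          y⊑br : y ⊑ br
          y⊑br with max-above y y∈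
          ... | b , mb , y⊑b with b ≟ br
          ...   | yes refl = y⊑b
          -- Under another maximal element, `z` would lie in D(b), hence in D(b₁), against its
          -- choice.
          ...   | no b≢br = contradiction (proj₁ (below-1 b mb b≢br z (⊑-trans z⊑y y⊑b , z≢b)))  z⋢b₁
            where
            z≢b : z ≢ b
            z≢b refl = proj₂ z⊏c (proj₂ mb _ (f∈ t zero) (proj₁ z⊏c))
          y⊏c : y ⊏ c
          y⊏c with cover t y y∈ y⊑br
          ... | inj₁ y⊑c = y⊑c , λ { refl → c⋢y ⊑-refl }
          ... | inj₂ (j , refl) = contradiction (mono t zero j z≤n) c⋢y
          f′ : Fin (suc (suc (m t))) → Fin n
          f′ zero    = y
          f′ (suc i) = f t i
          t′ : Tail
          m t′ = suc (m t)
          f t′ = f′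
          f∈ t′ zero = y∈
          f∈ t′ (suc i) = f∈ t i
          f⊑br t′ zero = y⊑br
          f⊑br t′ (suc i) = f⊑br t i
          mono t′ zero zero _ = ⊑-refl
          mono t′ zero (suc j) _ = ⊑-trans (proj₁ y⊏c) (mono t zero j z≤n)
          mono t′ (suc i) (suc j) (s≤s i≤j) = mono t i j i≤j
          reflects t′ zero j _ = z≤n
          reflects t′ (suc i) zero fi⊑y = contradiction (⊑-trans (mono t zero i z≤n) fi⊑y) c⋢y
          reflects t′ (suc i) (suc j) fi⊑fj = s≤s (reflects t i j fi⊑fj)
          cover t′ u u∈ u⊑br with cover t u u∈ u⊑br
          ... | inj₂ (j , fj≡u) = inj₂ (suc j , fj≡u)
          ... | inj₁ u⊑c with u ≟ c
          ...   | yes u≡c = inj₂ (suc zero , sym u≡c)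
          ...   | no u≢c = inj₁ (D⊑y u (u⊑c , u≢c))
          f⋢b₁ t′ y⊑b₁ = z⋢b₁ (⊑-trans z⊑y y⊑b₁)

        start : Tail
        start = record { f = λ (_ : Fin 1) → br ; f∈ = λ _ → proj₁ mr ; f⊑br = λ _ → ⊑-refl
          ; mono = λ _ _ _ → ⊑-refl ; reflects = λ { zero zero _ → z≤n } ; cover = λ _ _ → inj₁
          ; f⋢b₁ = max-⋢ mr (proj₁ m₁) (b₁≢br ∘ sym) }

        module Final (t : Tail) (bottom : Bottom t) where

          c = f t zero

          c⊑f : ∀ i → c ⊑ f t i
          c⊑f i = mono t zero i z≤n

          f⋢ : ∀ i → ¬ f t i ⊑ b₁
          f⋢ i fi⊑b₁ = f⋢b₁ t (⊑-trans (c⊑f i) fi⊑b₁)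

          -- If D(b₁) met `U`, it would split off at the bottom of the block: it is contained in D
          -- of every maximal element, and a non-maximal element outside it lies at or above `c`,
          -- which is above all elements of `U` in D(b₁).
          isolated : ∀ w → U w → ¬ w ⊏ b₁
          isolated w w∈ w⊏b₁ = indecomposable (vsum2 (low? b₁) (w , w∈ , w⊏b₁) (b₁ , proj₁ m₁ , λ b₁⊏b₁ → proj₂ b₁⊏b₁ refl) cut)
            where
            cut : ∀ x y → U x → U y → x ⊏ b₁ → ¬ y ⊏ b₁ → x ⊑ y
            cut x y x∈ y∈ x⊏b₁ ¬y⊏b₁ with Max? y | max-above y y∈
            ... | yes my | _ = proj₁ (1-below y my x x⊏b₁)
            ... | no ¬my | b , mb , y⊑b with b ≟ br
            ...   | no b≢br = contradiction (below-1 b mb b≢br y (y⊑b , λ { refl → ¬my mb })) ¬y⊏b₁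
            ...   | yes refl = ⊑-trans x⊑c c⊑y
              where
              c⊑y : c ⊑ y
              c⊑y with cover t y y∈ y⊑b
              ... | inj₂ (j , refl) = c⊑f j
              ... | inj₁ y⊑c with y ≟ c
              ...   | yes refl = ⊑-refl
              ...   | no y≢c with bottom y y∈ (y⊑c , y≢c)
              ...     | y⊑b₁ = contradiction (y⊑b₁ , λ { refl → ¬my m₁ }) ¬y⊏b₁
              x⊑c : x ⊑ c
              x⊑c with cover t x x∈ (proj₁ (1-below br mr x x⊏b₁))
              ... | inj₁ x⊑c = x⊑c
              ... | inj₂ (j , refl) = contradiction (proj₁ x⊏b₁) (f⋢ j)

          chain : ∀ u → U u → u ⊑ br → ∃ λ j → f t j ≡ u
          chain u u∈ u⊑br with cover t u u∈ u⊑br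
          ... | inj₂ found = found
          ... | inj₁ u⊑c with u ≟ c
          ...   | yes u≡c = zero , sym u≡c
          ...   | no u≢c with u ≟ b₁
          ...     | no u≢b₁ = contradiction (bottom u u∈ (u⊑c , u≢c) , u≢b₁) (isolated u u∈)
          ...     | yes refl = contradiction u⊑br (max-⋢ m₁ (proj₁ mr) b₁≢br)

          -- A maximal element other than `br` has its D inside D(b₁), so nothing of `U` lies
          -- strictly below it either.
          parts : ∀ u → U u → (∃ λ j → f t j ≡ u) ⊎ (Max u × u ≢ br)
          parts u u∈ with max-above u u∈
          ... | b , mb , u⊑b with b ≟ br | u ≟ b
          ...   | yes refl | _      = inj₁ (chain u u∈ u⊑b)
          ...   | no b≢br | yes refl = inj₂ (mb , b≢br)
          ...   | no b≢br | no u≢b  = contradiction (below-1 b mb b≢br u (u⊑b , u≢b)) (isolated u u∈)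

          f-inj : Injective _≡_ _≡_ (f t)
          f-inj {i} {j} eq = FP.≤-antisym (reflects t i j (subst (f t i ⊑_) eq ⊑-refl)) (reflects t j i (subst (_⊑ f t i) eq ⊑-refl))
            where import Data.Fin.Properties as FP

          module Other (b : Fin n) (mb : Max b) (b≢br : b ≢ br) where

            b⋢f : ∀ i → ¬ b ⊑ f t i
            b⋢f i b⊑ = max-⋢ mb (proj₁ mr) b≢br (⊑-trans b⊑ (f⊑br t i))

            f⋢b : ∀ i → ¬ f t i ⊑ b
            f⋢b i fi⊑b = isolated (f t i) (f∈ t i) (below-1 b mb b≢br _ (fi⊑b , λ { refl → b⋢f i ⊑-refl }))

            f≢b : ∀ i → f t i ≢ b
            f≢b i refl = f⋢b i ⊑-refl

          -- A witness that D(br) is not inside D(b₁) belongs to `U` and gives the chain a second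
          -- element.
          1≤m : 1 ≤ m t
          1≤m with ¬Below⇒witness ¬r1
          ... | z , (z⊑br , z≢br) , ¬z⊏b₁ = pos (m t) (f t) (chain z z∈ z⊑br) (chain br (proj₁ mr) ⊑-refl)
            where
            z∈ : U z
            z∈ with U? z
            ... | yes z∈ = z∈
            ... | no z∉ with interval z z∉
            ...   | inj₁ dn = contradiction (dn b₁ (proj₁ m₁) , λ { refl → z∉ (proj₁ m₁) }) ¬z⊏b₁
            ...   | inj₂ up = contradiction (up br (proj₁ mr)) (⊏⇒⋣ (z⊑br , z≢br))
            pos : ∀ m (f : Fin (suc m) → Fin n) → (∃ λ j → f j ≡ z) → (∃ λ j → f j ≡ br) → 1 ≤ m
            pos zero    _ (zero , refl) (zero , refl) = contradiction refl z≢br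
            pos (suc _) _ _             _             = s≤s z≤n

          module O₁ = Other b₁ m₁ b₁≢br

          inB : ¬ (∃ λ b → Max b × b ≢ br × b ≢ b₁) → InB P U
          inB none = suc (m t) , s≤s 1≤m , g , g∈ , onto , g-inj , rel
            where
            g : Fin (suc (suc (m t))) → Fin n
            g zero    = b₁
            g (suc i) = f t i
            g∈ : ∀ i → U (g i)
            g∈ zero    = proj₁ m₁
            g∈ (suc i) = f∈ t i
            onto : ∀ u → U u → ∃ λ j → g j ≡ u
            onto u u∈ with parts u u∈
            ... | inj₁ (j , eq) = suc j , eq
            ... | inj₂ (mu , u≢br) = zero , sym (decidable-stable (u ≟ b₁) λ u≢b₁ → none (u , mu , u≢br , u≢b₁))
            g-inj : Injective _≡_ _≡_ g
            g-inj {zero} {zero} _ = refl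
            g-inj {zero} {suc j} eq = contradiction (sym eq) (O₁.f≢b j)
            g-inj {suc i} {zero} eq = contradiction eq (O₁.f≢b i)
            g-inj {suc i} {suc j} eq = cong suc (f-inj eq)
            rel : ∀ i j → (ChainPlusPointRel (suc (m t)) i j → g i ⊑ g j) × (g i ⊑ g j → ChainPlusPointRel (suc (m t)) i j)
            rel zero zero = (λ _ → ⊑-refl) , λ _ → refl
            rel zero (suc j) = (λ ()) , λ b₁⊑ → ⊥-elim (O₁.b⋢f j b₁⊑)
            rel (suc i) zero = (λ ()) , λ f⊑ → f⋢ i f⊑
            rel (suc i) (suc j) = mono t i j , reflects t i j

          module Second (b₂ : Fin n) (m₂ : Max b₂) (b₂≢br : b₂ ≢ br) (b₂≢b₁ : b₂ ≢ b₁) where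

            module O₂ = Other b₂ m₂ b₂≢br

            below-2 : ∀ b → Max b → Below b₂ b
            below-2 b mb z z⊏b₂ = 1-below b mb z (below-1 b₂ m₂ b₂≢br z z⊏b₂)

            ¬r2 : ¬ Below br b₂
            ¬r2 r2 = ¬r1 λ z z⊏br → below-1 b₂ m₂ b₂≢br z (r2 z z⊏br)

            -- `b₁`, `b₂` and `b₃` would share the same D, smaller than D(br); the two extra points
            -- that `threeOfFour` requires then fit into the size of the down-set of `br`.
            no-third : ∀ b₃ → Max b₃ → b₃ ≢ br → b₃ ≢ b₁ → b₃ ≢ b₂ → ⊥
            no-third b₃ m₃ b₃≢br b₃≢b₁ b₃≢b₂ = ¬imp (recolourMax threeOfFour g g-max g-inj ¬below low)
              where
              g : Fin 4 → Fin n
              g = lookup (b₁ ∷ b₂ ∷ b₃ ∷ br ∷ [])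
              σ : Fin 3 → Fin 4
              σ = F.inject₁
              g-max : ∀ k → Max (g k)
              g-max zero = m₁
              g-max (suc zero) = m₂
              g-max (suc (suc zero)) = m₃
              g-max (suc (suc (suc zero))) = mr
              g-inj : Injective _≡_ _≡_ g
              g-inj {zero} {zero} _ = refl
              g-inj {zero} {suc zero} eq = contradiction (sym eq) b₂≢b₁
              g-inj {zero} {suc (suc zero)} eq = contradiction (sym eq) b₃≢b₁
              g-inj {zero} {suc (suc (suc zero))} eq = contradiction eq b₁≢br
              g-inj {suc zero} {zero} eq = contradiction eq b₂≢b₁
              g-inj {suc zero} {suc zero} _ = refl
              g-inj {suc zero} {suc (suc zero)} eq = contradiction (sym eq) b₃≢b₂
              g-inj {suc zero} {suc (suc (suc zero))} eq = contradiction eq b₂≢br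
              g-inj {suc (suc zero)} {zero} eq = contradiction eq b₃≢b₁
              g-inj {suc (suc zero)} {suc zero} eq = contradiction eq b₃≢b₂
              g-inj {suc (suc zero)} {suc (suc zero)} _ = refl
              g-inj {suc (suc zero)} {suc (suc (suc zero))} eq = contradiction eq b₃≢br
              g-inj {suc (suc (suc zero))} {zero} eq = contradiction (sym eq) b₁≢br
              g-inj {suc (suc (suc zero))} {suc zero} eq = contradiction (sym eq) b₂≢br
              g-inj {suc (suc (suc zero))} {suc (suc zero)} eq = contradiction (sym eq) b₃≢br
              g-inj {suc (suc (suc zero))} {suc (suc (suc zero))} _ = refl
              ¬r3 : ¬ Below br b₃
              ¬r3 r3 = ¬r1 λ z z⊏br → below-1 b₃ m₃ b₃≢br z (r3 z z⊏br)
              ¬r : ∀ i → ¬ Below br (g (σ i))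
              ¬r zero = ¬r1
              ¬r (suc zero) = ¬r2
              ¬r (suc (suc zero)) = ¬r3
              ¬below : ∀ k → (∀ i → σ i ≢ k) → ∀ i → ¬ Below (g k) (g (σ i))
              ¬below zero plain = contradiction refl (plain zero)
              ¬below (suc zero) plain = contradiction refl (plain (suc zero))
              ¬below (suc (suc zero)) plain = contradiction refl (plain (suc (suc zero)))
              ¬below (suc (suc (suc zero))) _ = ¬r
              low : ∀ i → ∃ λ y → 2 + ∣ down (g (σ i)) - g (σ i) ∣ ≤ ∣ down y ∣
              low i = br , 2+∣D∣≤ (below-r _ (g-max (σ i))) (¬r i)

            -- A chain c < f j₁, f j₂ and two isolated points: b₁ and b₂ share one ground point and are told apart
            -- by f j₁ and f j₂.
            long : ∀ (j₁ j₂ : Fin (suc (m t))) → 0 < toℕ j₁ → 0 < toℕ j₂ → j₁ ≢ j₂ → ⊥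
            long j₁ j₂ 0<j₁ 0<j₂ j₁≢j₂ = ¬imp (recolour anti p≢d (λ _ → b₂≢b₁ ∘ sym) above sep-ss sep-sp sep-ps low)
              where
              s p : Fin 2 → Fin n
              s zero    = b₁
              s (suc _) = b₂
              J : Fin 2 → Fin (suc (m t))
              J zero    = j₁
              J (suc _) = j₂
              p = f t ∘ J
              -- The index `suc zero` makes `b₂` the point that is freed.
              open Recolouring s p (λ _ → b₁) (suc zero)
              s-max : ∀ i → Max (s i)
              s-max zero    = m₁
              s-max (suc _) = m₂
              f⋢s : ∀ k i → ¬ f t k ⊑ s i
              f⋢s k zero    = O₁.f⋢b k
              f⋢s k (suc _) = O₂.f⋢b k
              anti : ∀ i j → s i ⊑ s j → i ≡ j
              anti zero zero _ = refl
              anti zero (suc zero) ⊑′ = contradiction ⊑′ (max-⋢ m₁ (proj₁ m₂) (b₂≢b₁ ∘ sym))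
              anti (suc zero) zero ⊑′ = contradiction ⊑′ (max-⋢ m₂ (proj₁ m₁) b₂≢b₁)
              anti (suc zero) (suc zero) _ = refl
              p≢d : ∀ i → p i ≢ b₂
              p≢d i = O₂.f≢b (J i)
              above : ∀ i y → s i ⊏ y → p i ⊑ y × b₁ ⊑ y
              above i y ⊏′ = let up = max-⊏ (s-max i) ⊏′ in up _ (f∈ t (J i)) , up _ (proj₁ m₁)
              fresh : ∀ i k → J i ≢ k → ¬ Coloured i (f t k)
              fresh i k _ (below (⊑′ , _)) = f⋢s k i ⊑′
              fresh i k ≢k (left eq) = ≢k (sym (f-inj eq))
              fresh i k _ (right eq) = O₁.f≢b k eq
              sep-ss : ∀ i j → i ≢ j → ∃ λ e → Coloured i e × ¬ Coloured j e
              sep-ss zero zero ≢′ = contradiction refl ≢′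
              sep-ss zero (suc zero) _ = _ , left refl , fresh (suc zero) j₁ (j₁≢j₂ ∘ sym)
              sep-ss (suc zero) zero _ = _ , left refl , fresh zero j₂ j₁≢j₂
              sep-ss (suc zero) (suc zero) ≢′ = contradiction refl ≢′
              sep-sp : ∀ i y → Plain y → ¬ s i ⊑ y → ∃ λ e → Coloured i e × ¬ e ⊑ y
              sep-sp i y plain ⋢y = b₁ , right refl , λ b₁⊑y →
                ⋢y (max-⊏ m₁ (b₁⊑y , plain zero) (s i) (proj₁ (s-max i)))
              sep-ps : ∀ i x → Plain x → x ≡ p i ⊎ x ≡ b₁ → ∃ λ z → z ⊏ x × z ≢ b₂ × ¬ Coloured i z
              sep-ps i x plain (inj₂ refl) = contradiction refl (plain zero)
              -- `J i` is positive, so the least chain element `c` lies strictly below `p i`; it is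
              -- not in the new set of `s i`.
              sep-ps i x plain (inj₁ refl) = c , (c⊑f (J i) , λ eq → positive i (f-inj eq)) , O₂.f≢b zero ,
                fresh i zero (positive i ∘ sym)
                where
                positive : ∀ i → zero ≢ J i
                positive zero refl    = contradiction 0<j₁ λ ()
                positive (suc _) refl = contradiction 0<j₂ λ ()
              low : ∀ i → ∃ λ y → ∣ colour i ∣ ≤ ∣ down y ∣
              low zero    = br , ≤-trans (∣colour∣≤ zero) (2+∣D∣≤ (1-below br mr) ¬r1)
              low (suc i) = br , ≤-trans (∣colour∣≤ (suc i)) (2+∣D∣≤ (below-2 br mr) ¬r2)

            isZ : IsZ P U
            -- The data of the tail are passed separately so that its length can be split: `long`
            -- excludes three or more chain elements, leaving two.
            isZ = go (m t) (f t) 1≤m (λ i → f∈ t i) (mono t) (reflects t) long parts O₁.f⋢b O₁.b⋢f O₂.f⋢b O₂.b⋢f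
              where
              go : ∀ m (f : Fin (suc m) → Fin n) → 1 ≤ m → (∀ i → U (f i)) → (∀ i j → i F.≤ j → f i ⊑ f j) →
                   (∀ i j → f i ⊑ f j → i F.≤ j) →
                   (∀ (j₁ j₂ : Fin (suc m)) → 0 < toℕ j₁ → 0 < toℕ j₂ → j₁ ≢ j₂ → ⊥) →
                   (∀ u → U u → (∃ λ j → f j ≡ u) ⊎ (Max u × u ≢ br)) →
                   (∀ i → ¬ f i ⊑ b₁) → (∀ i → ¬ b₁ ⊑ f i) → (∀ i → ¬ f i ⊑ b₂) → (∀ i → ¬ b₂ ⊑ f i) → IsZ P U
              go (suc (suc m)) _ _ _ _ _ long = ⊥-elim (long (suc zero) (suc (suc zero)) (s≤s z≤n) (s≤s z≤n) λ ())
              go (suc zero) f _ f∈ mono reflects _ parts f⋢b₁ b₁⋢f f⋢b₂ b₂⋢f =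
                g , g∈ , onto , (λ {i} {j} eq → inj i j (subst (g i ⊑_) eq ⊑-refl) (subst (_⊑ g i) eq ⊑-refl)) ,
                λ i j → (rel⁺ i j , rel⁻ i j)
                where
                g : Fin 4 → Fin n
                g = lookup (f zero ∷ f (suc zero) ∷ b₁ ∷ b₂ ∷ [])
                g∈ : ∀ i → U (g i)
                g∈ zero = f∈ zero
                g∈ (suc zero) = f∈ (suc zero)
                g∈ (suc (suc zero)) = proj₁ m₁
                g∈ (suc (suc (suc zero))) = proj₁ m₂
                onto : ∀ u → U u → ∃ λ j → g j ≡ u
                onto u u∈ with parts u u∈
                ... | inj₁ (zero , eq) = zero , eq
                ... | inj₁ (suc zero , eq) = suc zero , eq
                ... | inj₂ (mu , u≢br) with u ≟ b₁ | u ≟ b₂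
                ...   | yes refl | _ = suc (suc zero) , refl
                ...   | no _ | yes refl = suc (suc (suc zero)) , refl
                ...   | no u≢b₁ | no u≢b₂ = ⊥-elim (no-third u mu u≢br u≢b₁ u≢b₂)
                rel⁺ : ∀ i j → ZRel i j → g i ⊑ g j
                rel⁺ i .i (inj₁ refl) = ⊑-refl
                rel⁺ _ _ (inj₂ (refl , refl)) = mono zero (suc zero) z≤n
                rel⁻ : ∀ i j → g i ⊑ g j → ZRel i j
                rel⁻ zero zero _ = inj₁ refl
                rel⁻ zero (suc zero) _ = inj₂ (refl , refl)
                rel⁻ zero (suc (suc zero)) ⊑′ = contradiction ⊑′ (f⋢b₁ zero)
                rel⁻ zero (suc (suc (suc zero))) ⊑′ = contradiction ⊑′ (f⋢b₂ zero)
                rel⁻ (suc zero) zero ⊑′ = contradiction (reflects (suc zero) zero ⊑′) λ ()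
                rel⁻ (suc zero) (suc zero) _ = inj₁ refl
                rel⁻ (suc zero) (suc (suc zero)) ⊑′ = contradiction ⊑′ (f⋢b₁ (suc zero))
                rel⁻ (suc zero) (suc (suc (suc zero))) ⊑′ = contradiction ⊑′ (f⋢b₂ (suc zero))
                rel⁻ (suc (suc zero)) zero ⊑′ = contradiction ⊑′ (b₁⋢f zero)
                rel⁻ (suc (suc zero)) (suc zero) ⊑′ = contradiction ⊑′ (b₁⋢f (suc zero))
                rel⁻ (suc (suc zero)) (suc (suc zero)) _ = inj₁ refl
                rel⁻ (suc (suc zero)) (suc (suc (suc zero))) ⊑′ = contradiction ⊑′ (max-⋢ m₁ (proj₁ m₂) (b₂≢b₁ ∘ sym))
                rel⁻ (suc (suc (suc zero))) zero ⊑′ = contradiction ⊑′ (b₂⋢f zero)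
                rel⁻ (suc (suc (suc zero))) (suc zero) ⊑′ = contradiction ⊑′ (b₂⋢f (suc zero))
                rel⁻ (suc (suc (suc zero))) (suc (suc zero)) ⊑′ = contradiction ⊑′ (max-⋢ m₂ (proj₁ m₁) b₂≢b₁)
                rel⁻ (suc (suc (suc zero))) (suc (suc (suc zero))) _ = inj₁ refl
                inj : ∀ i j → g i ⊑ g j → g j ⊑ g i → i ≡ j
                inj i j ⊑′ ⊒′ with rel⁻ i j ⊑′ | rel⁻ j i ⊒′
                ... | inj₁ i≡j | _ = i≡j
                ... | inj₂ _ | inj₁ j≡i = sym j≡i
                ... | inj₂ (refl , refl) | inj₂ (() , _)

        result : InB P U ⊎ IsZ P U
        result with descend (suc (∣ down br ∣)) start (n<1+n _)
        ... | t , bottom with any? (λ b → Max? b ×-dec ¬? (b ≟ br) ×-dec ¬? (b ≟ b₁))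
        ...   | no none = inj₁ (Final.inB t bottom none)
        ...   | yes (b₂ , m₂ , b₂≢br , b₂≢b₁) = inj₂ (Final.Second.isZ t bottom b₂ m₂ b₂≢br b₂≢b₁)

      -- Comparability makes the sets D of the maximal elements a chain, with a largest D(br) and a
      -- smallest D(b₁). If these agree, all do.
      classify : InA P U ⊎ InB P U ⊎ IsZ P U
      classify with extremum Max? {Below} (λ _ _ → id) (λ xy yz w → yz w ∘ xy w) comparable some-max
                  | extremum Max? {λ x y → Below y x} (λ _ _ → id) (λ xy yz w → xy w ∘ yz w) (λ x y mx my → comparable y x my mx) some-max
      ... | br , mr , below-r | b₁ , m₁ , 1-below with Below? br b₁
      ...   | no ¬r1 = inj₂ (Main.result br b₁ mr m₁ ¬r1 below-r 1-below)
      ...   | yes r1 = inj₁ (Antichain.inA λ b c mb mc z z⊏b → 1-below c mc z (r1 z (below-r b mb z z⊏b)))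

  -- Sufficiency: every block of the required shape adds its size to the union

  module Decomposition (k : ℕ) (b : Fin (size P) → Fin (suc k)) (vsum : IsVSum P (suc k) b) where

    Block-of : Fin (suc k) → Sub P
    Block-of i = Part P b i

    b≤k : ∀ x → toℕ (b x) ≤ toℕ (F.fromℕ k)
    b≤k x = subst (toℕ (b x) ≤_) (sym (toℕ-fromℕ k)) (toℕ≤pred[n] (b x))

    module LowerBound {m} (S : Fin n → Subset m) (rep : IsInclRep P m S) where

      ∃∈∉ : ∀ {x y} → ¬ x ⊑ y → ∃ λ e → e ∈ S x × e ∉ S y
      ∃∈∉ {x} {y} x⋢y with any? (λ e → e ∈? S x ×-dec ¬? (e ∈? S y))
      ... | yes found = found
      ... | no none = contradiction
        (proj₂ (rep x y) λ {e} e∈x → decidable-stable (e ∈? S y) λ e∉y → none (e , e∈x , e∉y)) x⋢y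

      -- V stands for the union of the sets below block i, which all sets of the block contain, and Cond for what
      -- is known about the size of V; only a top antichain needs such a condition.
      Expands : (ℕ → Set) → Fin (suc k) → Set
      Expands Cond i = Σ ℕ λ c → Σ (Fin c → Fin n) λ f → (∀ j → b (f j) ≡ i) × (∀ x → b x ≡ i → ∃ λ j → f j ≡ x) ×
        (∀ V W → Cond ∣ V ∣ → (∀ j → V ⊆ S (f j)) → (∀ j → S (f j) ⊆ W) → ∣ V ∣ + c ≤ ∣ W ∣)

      -- A point that tells two elements of the block apart lies in `W` and outside `V`. If there
      -- were at most `c` points there, their patterns would separate all `suc c` elements.
      expands-incompressible : ∀ {c R Cond} i → (∀ x y → Dec (R x y)) → Incompressible {c} R →
                               IsoOn P (Block-of i) (suc c) R → Expands Cond i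
      expands-incompressible {c} {R} i R? inc (f , f∈ , onto , _ , iso) = suc c , f , f∈ , onto , bound
        where
        bound : ∀ V W → _ → (∀ j → V ⊆ S (f j)) → (∀ j → S (f j) ⊆ W) → ∣ V ∣ + suc c ≤ ∣ W ∣
        bound V W _ V⊆ ⊆W = decidable-stable (_ ≤? _) λ ≰W → inc (separated (small (≰⇒> ≰W)))
          where
          V⊆W : V ⊆ W
          V⊆W = ⊆W zero ∘ V⊆ zero
          small : ∣ W ∣ < ∣ V ∣ + suc c → ∣ W ─ V ∣ ≤ c
          small W< = +-cancelˡ-≤ ∣ V ∣ _ _ (begin
            ∣ V ∣ + ∣ W ─ V ∣      ≤⟨ +-monoˡ-≤ ∣ W ─ V ∣ (p⊆q⇒∣p∣≤∣q∣ {p = V} {q = W ∩ V} λ e∈ → x∈p∩q⁺ (V⊆W e∈ , e∈)) ⟩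
            ∣ W ∩ V ∣ + ∣ W ─ V ∣  ≡⟨ ∣p∩q∣+∣p─q∣≡∣p∣ W V ⟩
            ∣ W ∣                   ≤⟨ ≤-pred (≤-trans W< (≤-reflexive (+-suc ∣ V ∣ c))) ⟩
            ∣ V ∣ + c               ∎)
            where open ≤-Reasoning
          pattern-of : Fin m → Subset (suc c)
          pattern-of e = comprehension (λ j → e ∈? S (f j))
          separated : ∣ W ─ V ∣ ≤ c → ∃ λ ps → Separates R ps
          separated ∣W─V∣≤c with values ∅ (W ─ V) ∣W─V∣≤c pattern-of
          ... | ps , hit = ps , separates
            where
            separates : Separates R ps
            separates x y ¬xy with ∃∈∉ {f x} {f y} (¬xy ∘ proj₂ (iso x y))
            ... | e , e∈x , e∉y with hit (x∈p∧x∉q⇒x∈p─q (⊆W x e∈x) λ e∈V → e∉y (V⊆ y e∈V))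
            ...   | l , eq = l , subst (x ∈_) (sym eq) (∈-comprehension⁺ (λ j → e ∈? S (f j)) e∈x) ,
              λ y∈ → e∉y (∈-comprehension⁻ (λ j → e ∈? S (f j)) (subst (y ∈_) eq y∈))

      -- The bottom of the chain has a point outside `V`, since it is not below T; each step up adds
      -- a point, and T adds a last one because it is not below the top of the chain.
      expands-B : ∀ {Cond} i → InB P (Block-of i) → Expands Cond i
      expands-B i (suc m′ , _ , f , f∈ , onto , _ , iso) = suc (suc m′) , f , f∈ , onto , bound
        where
        bound : ∀ V W → _ → (∀ j → V ⊆ S (f j)) → (∀ j → S (f j) ⊆ W) → ∣ V ∣ + suc (suc m′) ≤ ∣ W ∣
        bound V W _ V⊆ ⊆W =
          let e , e∈T , e∉C = ∃∈∉ {f zero} {f (suc (F.fromℕ m′))} λ T⊑C → case proj₂ (iso zero (suc (F.fromℕ m′))) T⊑C of λ ()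
          in begin
            ∣ V ∣ + suc (suc m′)                        ≡⟨ +-suc ∣ V ∣ (suc m′) ⟩
            suc (∣ V ∣ + suc m′)                        ≡⟨ cong (λ l → suc (∣ V ∣ + suc l)) (toℕ-fromℕ m′) ⟨
            suc (∣ V ∣ + suc (toℕ (F.fromℕ m′)))        ≤⟨ s≤s (climb (F.fromℕ m′)) ⟩
            suc ∣ S (f (suc (F.fromℕ m′))) ∣            ≤⟨ p⊂q⇒∣p∣<∣q∣ (⊆W (suc (F.fromℕ m′)) , e , ⊆W zero e∈T , e∉C) ⟩
            ∣ W ∣                                       ∎
          where
          open ≤-Reasoning
          climb : ∀ j → ∣ V ∣ + suc (toℕ j) ≤ ∣ S (f (suc j)) ∣
          climb = <-weakInduction _ base step
            where
            base : ∣ V ∣ + 1 ≤ ∣ S (f (suc zero)) ∣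
            base with ∃∈∉ {f (suc zero)} {f zero} (proj₂ (iso (suc zero) zero))
            ... | e , e∈C , e∉T = subst (_≤ ∣ S (f (suc zero)) ∣) (+-comm 1 ∣ V ∣)
              (p⊂q⇒∣p∣<∣q∣ (V⊆ (suc zero) , e , e∈C , λ e∈V → e∉T (V⊆ zero e∈V)))
            step : ∀ j → ∣ V ∣ + suc (toℕ (F.inject₁ j)) ≤ ∣ S (f (suc (F.inject₁ j))) ∣ →
                   ∣ V ∣ + suc (suc (toℕ j)) ≤ ∣ S (f (suc (suc j))) ∣
            step j ih with ∃∈∉ {f (suc (suc j))} {f (suc (F.inject₁ j))}
                             (<⇒≱ (≤-reflexive (cong suc (toℕ-inject₁ j))) ∘ proj₂ (iso (suc (suc j)) (suc (F.inject₁ j))))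
            ... | e , e∈ , e∉ = begin
              ∣ V ∣ + suc (suc (toℕ j))             ≡⟨ +-suc ∣ V ∣ (suc (toℕ j)) ⟩
              suc (∣ V ∣ + suc (toℕ j))             ≡⟨ cong (λ l → suc (∣ V ∣ + suc l)) (toℕ-inject₁ j) ⟨
              suc (∣ V ∣ + suc (toℕ (F.inject₁ j))) ≤⟨ s≤s ih ⟩
              suc ∣ S (f (suc (F.inject₁ j))) ∣     ≤⟨ p⊂q⇒∣p∣<∣q∣ (proj₁ (rep _ _) lower , e , e∈ , e∉) ⟩
              ∣ S (f (suc (suc j))) ∣                ∎
              where
              lower : f (suc (F.inject₁ j)) ⊑ f (suc (suc j))
              lower = proj₁ (iso _ _) (≤-trans (≤-reflexive (toℕ-inject₁ j)) (n≤1+n (toℕ j)))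

      expands-A234 : ∀ {Cond} i → InA234 P (Block-of i) → Expands Cond i
      expands-A234 i (zero , () , _)
      expands-A234 i (suc zero , s≤s () , _)
      expands-A234 {Cond} i (suc (suc zero) , _ , _ , iso) = expands-incompressible {Cond = Cond} i _≟_ antichain₂ iso
      expands-A234 {Cond} i (suc (suc (suc zero)) , _ , _ , iso) = expands-incompressible {Cond = Cond} i _≟_ antichain₃ iso
      expands-A234 {Cond} i (suc (suc (suc (suc zero))) , _ , _ , iso) = expands-incompressible {Cond = Cond} i _≟_ antichain₄ iso
      expands-A234 {Cond} i (suc (suc (suc (suc (suc _)))) , _ , s≤s (s≤s (s≤s (s≤s ()))) , _)

      -- With sets of size at most ∣V∣ + 1 an antichain above V is represented by V plus distinct single points.
      expands-A : ∀ i → InA P (Block-of i) → Expands (λ v → ∀ x → ∣ S x ∣ ≤ v + 1) i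
      expands-A i (suc (suc c) , _ , f , f∈ , onto , inj , iso) = suc (suc c) , f , f∈ , onto , bound
        where
        bound : ∀ V W → (∀ x → ∣ S x ∣ ≤ ∣ V ∣ + 1) → (∀ j → V ⊆ S (f j)) → (∀ j → S (f j) ⊆ W) → ∣ V ∣ + suc (suc c) ≤ ∣ W ∣
        bound V W short V⊆ ⊆W = ∣p∣+k≤∣q∣ V W e (⊆W zero ∘ V⊆ zero) (λ {x} {y} → e-injective x y) λ j → ⊆W j (e∈ j) , e∉V j
          where
          other : Fin (suc (suc c)) → Fin (suc (suc c))
          other zero    = suc zero
          other (suc _) = zero
          apart : ∀ j → ¬ f j ⊑ f (other j)
          apart zero ⊑′ = case proj₂ (iso zero (suc zero)) ⊑′ of λ ()
          apart (suc j) ⊑′ = case proj₂ (iso (suc j) zero) ⊑′ of λ ()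
          e : Fin (suc (suc c)) → Fin m
          e j = proj₁ (∃∈∉ (apart j))
          e∈ : ∀ j → e j ∈ S (f j)
          e∈ j = proj₁ (proj₂ (∃∈∉ (apart j)))
          e∉V : ∀ j → e j ∉ V
          e∉V j e∈V = proj₂ (proj₂ (∃∈∉ (apart j))) (V⊆ (other j) e∈V)
          e-injective : ∀ x y → e x ≡ e y → x ≡ y
          -- If `e x` were also the point of `f y`, then `e′` would be a second point of `f x`
          -- outside `V`, which the size bound forbids.
          e-injective x y ex≡ey = decidable-stable (x ≟ y) λ x≢y →
            let e′ , e′∈x , e′∉y = ∃∈∉ {f x} {f y} (λ ⊑′ → x≢y (proj₂ (iso x y) ⊑′))
            in <⇒≱ (p⊂q⇒∣p∣<∣q∣ {p = V ∪ ⁅ e x ⁆} {q = S (f x)}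
                 ( (λ z∈ → case x∈p∪q⁻ V ⁅ e x ⁆ z∈ of λ where
                     (inj₁ z∈V) → V⊆ x z∈V
                     (inj₂ z∈e) → subst (_∈ S (f x)) (sym (x∈⁅y⁆⇒x≡y (e x) z∈e)) (e∈ x))
                 , e′ , e′∈x
                 , λ e′∈ → case x∈p∪q⁻ V ⁅ e x ⁆ e′∈ of λ where
                     (inj₁ e′∈V) → e′∉y (V⊆ y e′∈V)
                     (inj₂ e′∈e) → e′∉y (subst (_∈ S (f y)) (trans (sym ex≡ey) (sym (x∈⁅y⁆⇒x≡y (e x) e′∈e))) (e∈ y))))
               (≤-trans (short (f x)) (≤-trans (≤-reflexive (+-comm ∣ V ∣ 1)) (∣p∣<∣p∪⁅x⁆∣ V (e∉V x))))
      expands-A i (zero , () , _)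
      expands-A i (suc zero , s≤s () , _)

      lower? : ∀ j → Decidable (λ x → toℕ (b x) < j)
      lower? j x = toℕ (b x) <? j

      covered? : ∀ j → Decidable (λ e → ∃ λ x → toℕ (b x) < j × e ∈ S x)
      covered? j e = any? (λ x → lower? j x ×-dec e ∈? S x)

      Lower : ℕ → Subset n
      Lower j = comprehension (lower? j)

      Covered : ℕ → Subset m
      Covered j = comprehension (covered? j)

      Covered⊆ : ∀ {i x} → b x ≡ i → Covered (toℕ i) ⊆ S x
      Covered⊆ {i} {x} refl e∈ with ∈-comprehension⁻ (covered? (toℕ i)) e∈
      ... | y , y< , e∈y = proj₁ (rep y x) (proj₂ vsum y x y<) e∈y

      grow : ∀ {Cond} i → Expands Cond i → Cond ∣ Covered (toℕ i) ∣ → ∣ Lower (toℕ i) ∣ ≤ ∣ Covered (toℕ i) ∣ →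
             ∣ Lower (suc (toℕ i)) ∣ ≤ ∣ Covered (suc (toℕ i)) ∣
      grow {Cond} i (c , f , f∈ , onto , bound) cond ih = begin
        ∣ Lower (suc (toℕ i)) ∣      ≤⟨ ∣p∣≤∣q∣+k (Lower (suc (toℕ i))) (Lower (toℕ i)) f split ⟩
        ∣ Lower (toℕ i) ∣ + c        ≤⟨ +-monoˡ-≤ c ih ⟩
        ∣ Covered (toℕ i) ∣ + c      ≤⟨ bound (Covered (toℕ i)) (Covered (suc (toℕ i))) cond (Covered⊆ ∘ f∈) ⊆Covered ⟩
        ∣ Covered (suc (toℕ i)) ∣    ∎
        where
        open ≤-Reasoning
        ⊆Covered : ∀ j → S (f j) ⊆ Covered (suc (toℕ i))
        ⊆Covered j e∈ = ∈-comprehension⁺ (covered? (suc (toℕ i))) (f j , s≤s (≤-reflexive (cong toℕ (f∈ j))) , e∈)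
        split : ∀ {x} → x ∈ Lower (suc (toℕ i)) → x ∈ Lower (toℕ i) ⊎ ∃ λ j → f j ≡ x
        split {x} x∈ with toℕ (b x) <? toℕ i
        ... | yes x< = inj₁ (∈-comprehension⁺ (lower? (toℕ i)) x<)
        ... | no x≮ = inj₂ (onto x (toℕ-injective (≤-antisym (≤-pred (∈-comprehension⁻ (lower? (suc (toℕ i))) x∈)) (≮⇒≥ x≮))))

      -- The vacuous condition on the size of `V`, with proof `z≤n`.
      Always : ℕ → Set
      Always _ = 0 ≤ 0

      lower-blocks : (∀ (j : Fin k) → Expands Always (F.inject₁ j)) → ∀ (i : Fin (suc k)) → ∣ Lower (toℕ i) ∣ ≤ ∣ Covered (toℕ i) ∣
      lower-blocks expands = <-weakInduction _
        (≤-trans (p⊆q⇒∣p∣≤∣q∣ {p = Lower 0} {q = ∅} λ x∈ → contradiction (∈-comprehension⁻ (lower? 0) x∈) λ ())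
                 (≤-trans (≤-reflexive (∣⊥∣≡0 n)) z≤n))
        λ j ih → subst (λ l → ∣ Lower l ∣ ≤ ∣ Covered l ∣) (cong suc (toℕ-inject₁ j))
                   (grow {Always} (F.inject₁ j) (expands j) z≤n ih)

      -- `cond` may use that the lower blocks are already counted; a top antichain derives its bound
      -- on set sizes from this.
      total : ∀ {Cond} → (∀ (j : Fin k) → Expands Always (F.inject₁ j)) → Expands Cond (F.fromℕ k) →
              (∣ Lower k ∣ ≤ ∣ Covered k ∣ → Cond ∣ Covered k ∣) → n ≤ unionSize P S
      total {Cond} expands top cond = begin
        n                      ≡⟨ ∣⊤∣≡n n ⟨
        ∣ ⊤ {n} ∣              ≤⟨ p⊆q⇒∣p∣≤∣q∣ {p = ⊤} {q = Lower (suc k′)} (λ {x} _ → ∈-comprehension⁺ (lower? (suc k′)) (s≤s (b≤k x))) ⟩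
        ∣ Lower (suc k′) ∣     ≤⟨ grow {Cond} (F.fromℕ k) top cond′ (lower-blocks expands (F.fromℕ k)) ⟩
        ∣ Covered (suc k′) ∣   ≤⟨ p⊆q⇒∣p∣≤∣q∣ Covered⊆⋃ ⟩
        unionSize P S          ∎
        where
        open ≤-Reasoning
        k′ = toℕ (F.fromℕ k)
        Covered⊆⋃ : Covered (suc k′) ⊆ ⋃ (tabulateL S)
        Covered⊆⋃ e∈ = let x , _ , e∈x = ∈-comprehension⁻ (covered? (suc k′)) e∈ in ∈⋃⁺ S x e∈x
        cond′ : Cond ∣ Covered k′ ∣
        cond′ = subst (λ l → ∣ Lower l ∣ ≤ ∣ Covered l ∣ → Cond ∣ Covered l ∣) (sym (toℕ-fromℕ k)) cond
                  (lower-blocks expands (F.fromℕ k))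

    -- Below a top antichain or inside it every `y` qualifies, so the admissible sets have at most
    -- one point more than there are elements in the lower blocks.
    ∣down∣≤ : ∀ y → (∀ z → b z ≡ F.fromℕ k → z ⊑ y → z ≡ y) → ∣ down y ∣ ≤ ∣ comprehension (λ x → toℕ (b x) <? k) ∣ + 1
    ∣down∣≤ y minimal = ∣p∣≤∣q∣+k (down y) (comprehension (λ x → toℕ (b x) <? k)) (λ (_ : Fin 1) → y) split
      where
      split : ∀ {x} → x ∈ down y → x ∈ comprehension (λ x → toℕ (b x) <? k) ⊎ ∃ λ (_ : Fin 1) → y ≡ x
      split {x} x∈ with toℕ (b x) <? k
      ... | yes x< = inj₁ (∈-comprehension⁺ (λ x → toℕ (b x) <? k) x<)
      ... | no x≮ = inj₂ (zero , sym (minimal x bx≡k (∈-down⁻ x∈)))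
        where
        bx≡k : b x ≡ F.fromℕ k
        bx≡k = toℕ-injective (≤-antisym (b≤k x) (subst (_≤ toℕ (b x)) (sym (toℕ-fromℕ k)) (≮⇒≥ x≮)))

    condition⇒isCw : CwCondition P k b → IsCw P n
    condition⇒isCw (top , lower) = isCw⁺ bound
      where
      bound : ∀ m (S : Fin n → Subset m) → IsInclRep P m S → Bounded P S ∣ down (proj₁ tallest) ∣ → n ≤ unionSize P S
      bound m S rep bounded = go top
        where
        open LowerBound S rep
        expands : ∀ (j : Fin k) → Expands Always (F.inject₁ j)
        expands j with lower j
        ... | inj₁ a        = expands-A234 {Always} _ a
        ... | inj₂ (inj₁ c) = expands-B {Always} _ c
        ... | inj₂ (inj₂ z) = expands-incompressible {Cond = Always} _ ZRel? z-incompressible z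
        go : _ → n ≤ unionSize P S
        go (inj₂ (inj₁ c)) = total {Always} expands (expands-B {Always} _ c) λ _ → z≤n
        go (inj₂ (inj₂ z)) = total {Always} expands (expands-incompressible {Cond = Always} _ ZRel? z-incompressible z) λ _ → z≤n
        go (inj₁ a@(_ , _ , f , f∈ , onto , _ , iso)) = total {λ v → ∀ x → ∣ S x ∣ ≤ v + 1} expands (expands-A _ a) λ L≤ x → begin
          ∣ S x ∣             ≤⟨ bounded x ⟩
          ∣ down y ∣        ≤⟨ ∣down∣≤-tallest ⟩
          ∣ Lower k ∣ + 1     ≤⟨ +-monoˡ-≤ 1 L≤ ⟩
          ∣ Covered k ∣ + 1   ∎
          where
          open ≤-Reasoning
          y = proj₁ (tallest)
          minimal : ∀ j z → b z ≡ F.fromℕ k → z ⊑ f j → z ≡ f j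
          minimal j z z∈ z⊑ with onto z z∈
          ... | i , refl = cong f (proj₂ (iso i j) z⊑)
          ∣down∣≤-tallest : ∣ down y ∣ ≤ ∣ Lower k ∣ + 1
          ∣down∣≤-tallest = ∣down∣≤ y λ z z∈ z⊑y → in-top z z∈ z⊑y
            where
            in-top : ∀ z → b z ≡ F.fromℕ k → z ⊑ y → z ≡ y
            in-top z z∈ z⊑y with F.fromℕ k ≟ b y
            ... | yes k≡by with onto y (sym k≡by)
            ...   | j , fj≡y = trans (minimal j z z∈ (subst (z ⊑_) (sym fj≡y) z⊑y)) fj≡y
            in-top z z∈ z⊑y | no k≢by = ⊑-antisym z⊑y (proj₂ vsum y z (subst (b y F.<_) (sym z∈)
              (≤∧≢⇒< (b≤k y) λ eq → k≢by (sym (toℕ-injective eq)))))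

    -- Necessity: without an improvement every block has the required shape

    module Classification (blocks : AllBlocks P (suc k) b) (¬imp : ¬ Improvement) where

      interval : ∀ i x → b x ≢ i → (∀ u → b u ≡ i → x ⊑ u) ⊎ (∀ u → b u ≡ i → u ⊑ x)
      interval i x x∉ with FP.<-cmp (b x) i
      ... | tri< x< _ _ = inj₁ λ { u refl → proj₂ vsum x u x< }
      ... | tri≈ _ x≡ _ = contradiction x≡ x∉
      ... | tri> _ _ x> = inj₂ λ { u refl → proj₂ vsum u x x> }

      module B (i : Fin (suc k)) = Block (Block-of i) (λ x → b x ≟ i) (interval i)

      Incomparable : Fin (suc k) → Set
      Incomparable i = ∃ λ u → ∃ λ v → b u ≡ i × b v ≡ i × ¬ u ⊑ v × ¬ v ⊑ u

      Incomparable? : ∀ i → Dec (Incomparable i)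
      Incomparable? i = any? λ u → any? λ v → b u ≟ i ×-dec b v ≟ i ×-dec ¬? (u ⊑? v) ×-dec ¬? (v ⊑? u)

      indecomposable : ∀ i → Incomparable i → ¬ IsVSum2On P (Block-of i)
      indecomposable i (u , v , u∈ , v∈ , u⋢v , v⋢u) with blocks i
      ... | inj₂ ¬vs = ¬vs
      ... | inj₁ chain = contradiction (chain u v u∈ v∈) [ u⋢v , v⋢u ]′

      -- A maximum `y` would make the block the vertical sum of the rest and `y`.
      no-maximum : ∀ i → Incomparable i → ∀ y → b y ≡ i → ∃ λ z → b z ≡ i × ¬ z ⊑ y
      no-maximum i inc@(u , v , u∈ , v∈ , u⋢v , v⋢u) y y∈ with any? (λ z → b z ≟ i ×-dec ¬? (z ⊑? y))
      ... | yes found = found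
      ... | no none = contradiction
        (B.vsum2 i {Low = _≢ y} (λ x → ¬? (x ≟ y)) low (y , y∈ , λ y≢y → y≢y refl)
          λ x y′ x∈ _ _ ¬≢ → subst (x ⊑_) (sym (decidable-stable (y′ ≟ y) ¬≢)) (below-y x x∈))
        (indecomposable i inc)
        where
        below-y : ∀ z → b z ≡ i → z ⊑ y
        below-y z z∈ = decidable-stable (z ⊑? y) λ z⋢y → none (z , z∈ , z⋢y)
        low : ∃ λ x → b x ≡ i × x ≢ y
        low = u , u∈ , λ { refl → v⋢u (below-y v v∈) }

      -- Induction over the blocks from the bottom. If block `i` were a chain with least element
      -- `m`, then for every `y` in a lower block some element of the lower blocks would not be
      -- below `y`, and the point of `m` could be removed.
      incomparable : ∀ i → Incomparable i
      incomparable = <-weakInduction Incomparable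
        (not-chain zero λ y by<0 → contradiction by<0 λ ())
        λ j inc → not-chain (suc j) (below j inc)
        where
        not-chain : ∀ i → (∀ y → b y F.< i → ∃ λ z → b z F.< i × ¬ z ⊑ y) → Incomparable i
        not-chain i below with Incomparable? i
        ... | yes inc = inc
        ... | no ¬inc with extremum (λ x → b x ≟ i) {λ x y → y ⊑ x} (λ _ → ⊑-refl) (λ yx zy → ⊑-trans zy yx) chain (proj₁ vsum i)
          where
          chain : ∀ x y → b x ≡ i → b y ≡ i → y ⊑ x ⊎ x ⊑ y
          chain x y x∈ y∈ with y ⊑? x | x ⊑? y
          ... | yes yx | _      = inj₁ yx
          ... | no _   | yes xy = inj₂ xy
          ... | no ¬yx | no ¬xy = contradiction (x , y , x∈ , y∈ , ¬xy , ¬yx) ¬inc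
        ...   | m , m∈ , least = contradiction (remove m removable) ¬imp
          where
          removable : ∀ y → ¬ m ⊑ y → ∃ λ z → z ⊏ m × ¬ z ⊑ y
          removable y m⋢y with FP.<-cmp (b y) i
          ... | tri≈ _ y∈ _ = contradiction (least y y∈) m⋢y
          ... | tri> _ _ y> = contradiction (proj₂ vsum m y (subst (F._< b y) (sym m∈) y>)) m⋢y
          ... | tri< y< _ _ with below y y<
          ...   | z , z< , z⋢y = z , (proj₂ vsum z m (subst (b z F.<_) (sym m∈) z<) , λ { refl → <-irrefl (cong toℕ m∈) z< }) , z⋢y
        -- If `y` is in block `j` itself, this block has no maximum; if `y` is lower, any element of
        -- block `j` will do.
        below : ∀ (j : Fin k) → Incomparable (F.inject₁ j) → ∀ y → b y F.< suc j → ∃ λ z → b z F.< suc j × ¬ z ⊑ y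
        below j inc y y< with b y ≟ F.inject₁ j
        ... | yes y∈ with no-maximum (F.inject₁ j) inc y y∈
        ...   | z , z∈ , z⋢y = z , s≤s (≤-reflexive (trans (cong toℕ z∈) (toℕ-inject₁ j))) , z⋢y
        below j (u , _ , u∈ , _) y y< | no y∉ = u , s≤s (≤-reflexive (trans (cong toℕ u∈) (toℕ-inject₁ j))) ,
          λ u⊑y → y∉ (subst (λ w → b w ≡ F.inject₁ j) (⊑-antisym u⊑y (proj₂ vsum y u by<bu)) u∈)
          where
          by<bu : b y F.< b u
          by<bu = subst (b y F.<_) (sym u∈) (≤∧≢⇒< (subst (toℕ (b y) ≤_) (sym (toℕ-inject₁ j)) (≤-pred y<)) (y∉ ∘ toℕ-injective))

      classify : ∀ i → InA P (Block-of i) ⊎ InB P (Block-of i) ⊎ IsZ P (Block-of i)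
      classify i = let inc@(u , v , u∈ , v∈ , u⋢v , v⋢u) = incomparable i in
        B.Classify.classify i ¬imp (indecomposable i inc) u v u∈ v∈ u⋢v v⋢u

      -- By `fiveOfFive` five elements could be represented over four of their points. The new sets
      -- may be one larger than the old down-sets, and an element of the top block, lying above all
      -- five, has a down-set of that size.
      small-antichain : ∀ (j : Fin k) → InA P (Block-of (F.inject₁ j)) → InA234 P (Block-of (F.inject₁ j))
      small-antichain j (c , 2≤c , iso@(f , f∈ , onto , inj , rel)) with c ≤? 4
      ... | yes c≤4 = c , 2≤c , c≤4 , iso
      ... | no c≰4 = contradiction
        (B.recolourMax (F.inject₁ j) fiveOfFive g g-max (λ eq → inject≤-injective 5≤c 5≤c _ _ (inj eq))
          (λ l plain → contradiction refl (plain l)) low) ¬imp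
        where
        5≤c : 5 ≤ c
        5≤c = ≰⇒> c≰4
        g : Fin 5 → Fin n
        g l = f (F.inject≤ l 5≤c)
        g-max : ∀ l → B.Max (F.inject₁ j) (g l)
        g-max l = f∈ _ , mx
          where
          mx : ∀ y → b y ≡ F.inject₁ j → g l ⊑ y → g l ≡ y
          mx y y∈ ⊑y with onto y y∈
          ... | i , refl = cong f (proj₂ (rel _ i) ⊑y)
        y = proj₁ (proj₁ vsum (F.fromℕ k))
        g⊏y : ∀ l → g l ⊏ y
        g⊏y l = proj₂ vsum (g l) y bg<by , λ eq → <-irrefl (cong (toℕ ∘ b) eq) bg<by
          where
          bg<by : b (g l) F.< b y
          bg<by = subst₂ _<_ (sym (trans (cong toℕ (f∈ _)) (toℕ-inject₁ j)))
            (sym (trans (cong toℕ (proj₂ (proj₁ vsum (F.fromℕ k)))) (toℕ-fromℕ k))) (FP.toℕ<n j)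
        low : ∀ l → ∃ λ y → 2 + ∣ down (g l) - g l ∣ ≤ ∣ down y ∣
        low l = y , 2+∣D∣≤ (λ z (z⊑ , z≢) → ⊑-trans z⊑ (proj₁ (g⊏y l)) , λ { refl → z≢ (⊑-antisym z⊑ (proj₁ (g⊏y l))) })
                             (λ below → proj₂ (below (g l) (g⊏y l)) refl)

      condition : CwCondition P k b
      condition = classify (F.fromℕ k) , λ j → [ inj₁ ∘ small-antichain j , inj₂ ]′ (classify (F.inject₁ j))

-- From the definition of the block decomposition to the equivalence

decomposition-blocks : ∀ (P : FinPoset) k b → IsBlockDecomposition P k b → AllBlocks P (suc k) b
decomposition-blocks P k b (_ , inj₂ (_ , _ , blocks , _)) = blocks
-- With one block the definition speaks of `Whole P`, which coincides with the only part.
decomposition-blocks P _ b (_ , inj₁ (refl , whole)) i with whole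
... | inj₁ chain = inj₁ λ x y _ _ → chain x y _ _
... | inj₂ ¬vs   = inj₂ λ { (c , (x , _ , cx) , (y , _ , cy) , cut) →
  ¬vs (c , (x , _ , cx) , (y , _ , cy) , λ x y _ _ → cut x y (in-block x) (in-block y)) }
  where
  unique : ∀ (i j : Fin 1) → i ≡ j
  unique zero zero = refl
  in-block : ∀ x → b x ≡ i
  in-block x = unique (b x) i

theorem5p2 : (P : FinPoset) (k : ℕ) (b : Fin (size P) → Fin (suc k)) →
    IsBlockDecomposition P k b →
    (IsCw P (size P) → CwCondition P k b) × (CwCondition P k b → IsCw P (size P))
theorem5p2 P k b dec =
  (λ cw → Classification.condition (decomposition-blocks P k b dec) (isCw⇒¬Improvement P cw)) , condition⇒isCw
  where open Decomposition P k b (proj₁ dec)
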